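{- For every positive integer $k$, $g_{k}(K_3,GR_k(K_3))=1$ if $k$ is odd, and $g_{k}(K_3,GR_k(K_3))=2$ if $k$ is even.
   Context: A Gallai-$k$-coloring is an edge-coloring of a complete graph with colors from $[k]$ containing no rainbow triangle (triangle with three distinct colors). $GR_k(K_3)$ is the minimum integer $N$ such that every Gallai-$k$-coloring of $K_N$ contains a monochromatic triangle. $g_k(K_3,n)$ is the minimum number of monochromatic triangles taken over all Gallai-$k$-colorings of $K_n$. -}

module Defs where

open import Data.Nat using (ℕ; zero; suc; _+_; _≤_; _<_)
open import Data.Nat.Properties using (_≟_)
open import Data.Fin using (Fin; toℕ)
open import Data.Fin.Properties renaming (_≟_ to _≟ᶠ_)
open import Data.List using (List; map; allFin)
open import Data.Nat.ListAction using (sum)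
open import Data.Product using (_×_; Σ; ∃; _,_)
open import Relation.Nullary using (¬_; Dec; yes; no)
open import Relation.Binary.PropositionalEquality using (_≡_; _≢_)

-- An edge-colouring of the complete graph K_n with colours in [k] = Fin k.
-- Only the values on pairs of distinct vertices matter; we require symmetry.
Coloring : ℕ → ℕ → Set
Coloring k n = Fin n → Fin n → Fin k

Symmetric : ∀ {k n} → Coloring k n → Set
Symmetric {k} {n} c = (i j : Fin n) → i ≢ j → c i j ≡ c j i

RainbowTriangle : ∀ {k n} → Coloring k n → Fin n → Fin n → Fin n → Set
RainbowTriangle c i j l =
  i ≢ j × j ≢ l × i ≢ l ×
  c i j ≢ c j l × c j l ≢ c i l × c i j ≢ c i l

Gallai : (k n : ℕ) → Coloring k n → Set
Gallai k n c = Symmetric c × ((i j l : Fin n) → ¬ RainbowTriangle c i j l)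

MonoTriangle : ∀ {k n} → Coloring k n → Fin n → Fin n → Fin n → Set
MonoTriangle c i j l = i ≢ j × j ≢ l × i ≢ l × c i j ≡ c j l × c j l ≡ c i l

monoIndicator : ∀ {k n} → Coloring k n → Fin n → Fin n → Fin n → ℕ
monoIndicator c i j l with toℕ i Data.Nat.<? toℕ j | toℕ j Data.Nat.<? toℕ l
                          | c i j ≟ᶠ c j l | c j l ≟ᶠ c i l
... | yes _ | yes _ | yes _ | yes _ = 1
... | _     | _     | _     | _     = 0

numMono : ∀ {k n} → Coloring k n → ℕ
numMono {k} {n} c =
  sum (map (λ i → sum (map (λ j → sum (map (λ l → monoIndicator c i j l) (allFin n))) (allFin n))) (allFin n))

ForcesMono : (k N : ℕ) → Set
ForcesMono k N = (c : Coloring k N) → Gallai k N c →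
                 ∃ λ i → ∃ λ j → ∃ λ l → MonoTriangle c i j l

IsGR : (k N : ℕ) → Set
IsGR k N = ForcesMono k N × ((M : ℕ) → M < N → ¬ ForcesMono k M)

IsG : (k n m : ℕ) → Set
IsG k n m = (Σ (Coloring k n) λ c → Gallai k n c × numMono c ≡ m)
          × ((c : Coloring k n) → Gallai k n c → m ≤ numMono c)

{-# OPTIONS --safe #-}
module Submission where

open import Defs
open import Data.Bool using (Bool; true; false; if_then_else_; _∨_)
import Data.Bool.Properties as Boolₚ
open import Data.Fin using (Fin; zero; suc; toℕ; fromℕ<)
import Data.Fin.Properties as Finₚ
open import Data.List using (List; []; _∷_; _++_; length; filter; map; allFin; cartesianProduct)
open import Data.List.Membership.Propositional using (_∈_; _∉_; find; lose)
open import Data.List.Membership.Propositional.Properties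
  using (∈-filter⁺; ∈-filter⁻; ∈-length; ∈-∃++; ∈-++⁺ˡ; ∈-++⁺ʳ; ∈-++⁻; ∈-allFin; ∈-cartesianProduct⁺;
    ∈-map⁺; ∈-map⁻)
open import Data.List.Properties
  using (filter-++; filter-accept; filter-none; filter-notAll; filter-reject; length-++; length-map;
    length-tabulate; map-cong)
open import Data.List.Relation.Binary.Permutation.Propositional
  using (_↭_; ↭⇒↭ₛ; ↭-refl; ↭-sym; ↭-trans; prep; swap)
open import Data.List.Relation.Binary.Permutation.Propositional.Properties using (∈-resp-↭)
import Data.List.Relation.Binary.Permutation.Setoid.Properties as Permₛ
open import Data.List.Relation.Unary.All as All using (All; []; _∷_)
open import Data.List.Relation.Unary.All.Properties using (¬All⇒Any¬)
open import Data.List.Relation.Unary.AllPairs using (AllPairs; []; _∷_)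
open import Data.List.Relation.Unary.Any as Any using (Any; here; there)
open import Data.List.Relation.Unary.Unique.Propositional using (Unique)
open import Data.List.Relation.Unary.Unique.Propositional.Properties
  using (Unique[x∷xs]⇒x∉xs; allFin⁺; cartesianProduct⁺; filter⁺; map⁺)
open import Data.Maybe using (Maybe; just; nothing)
import Data.Maybe.Properties as Maybeₚ
open import Data.Nat
  using (ℕ; zero; suc; _+_; _*_; _/_; _≤_; _<_; _≤?_; _<?_; z≤n; s≤s; s≤s⁻¹; >-nonZero)
open import Data.Nat.Divisibility using (_∣_; divides; _∣0; ∣1⇒≡1; ∣m+n∣m⇒∣n)
open import Data.Nat.DivMod using (_mod_; m≡m%n+[m/n]*n; m*n/n≡m; /-mono-≤)
open import Data.Nat.ListAction using (sum)
open import Data.Nat.Properties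
  using (_≟_; ≤-refl; ≤-reflexive; ≤-trans; ≤-antisym; ≤∧≢⇒<; <-cmp; <-irrefl; <⇒≤; <⇒≱; n≤0⇒n≡0;
    m≤m+n; m≤n+m; m≤n⇒m≤1+n; suc-injective; +-comm; +-suc; +-identityʳ; +-cancelˡ-≤;
    +-cancelʳ-≤; +-mono-≤; +-monoˡ-≤; +-monoʳ-≤; *-comm; *-monoʳ-≤; *-monoˡ-<;
    module ≤-Reasoning)
open import Data.Nat.Tactic.RingSolver using (solve-∀)
open import Data.Product using (Σ; ∃; ∃₂; _×_; _,_; proj₁; proj₂)
import Data.Product.Properties as Productₚ
open import Data.Sum using (_⊎_; inj₁; inj₂; [_,_]′)
open import Function using (_∘_)
open import Relation.Binary.Definitions using (DecidableEquality; tri<; tri≈; tri>)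
open import Relation.Binary.PropositionalEquality
  using (_≡_; _≢_; refl; sym; trans; cong; cong₂; subst; subst₂; setoid; module ≡-Reasoning)
open import Relation.Nullary using (¬_; Dec; yes; no; contradiction; does)
open import Relation.Nullary.Decidable using (map′; _⊎-dec_; _×-dec_; _→-dec_; ¬?; from-yes)
open import Relation.Unary using (Decidable)

-- Let f(2h) = 5^h and f(2h+1) = 2 · 5^h; then GR_k(K₃) = f(k) + 1. By Gallai's theorem the vertices of
-- a Gallai coloring split into parts with a single color between any two parts and at most two colors
-- a, b overall. Without monochromatic triangles, either some cut is monochromatic and both sides avoid
-- its color, or every part sees both a and b; then the parts avoid a and b and there are at most five
-- of them. Induction gives at most f(k) vertices.
-- For even k = 2h the first case is never tight, and in the second a vertex has 2 · 5^(h-1) neighbors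
-- in each of a and b; hence all color degrees are even when f(k) vertices carry no monochromatic
-- triangle. Deleting either of two vertices of a unique monochromatic triangle leaves such a coloring,
-- and comparing the degrees in the two gives a second triangle.
-- Blowing up the pentagon gives extremal colorings: give all of ℕ the color of the lowest base-5 digit
-- that differs. On {0, …, f(k)} only the residue class 0 mod 5 is larger than its share, so the
-- monochromatic triangles are 5 times those of the coloring with two colors fewer.

-- Counting list entries.

count : ∀ {A : Set} {P : A → Set} → Decidable P → List A → ℕ
count P? xs = length (filter P? xs)

module _ {A : Set} {P Q : A → Set} (P? : Decidable P) (Q? : Decidable Q) where

  count-split : ∀ xs → count P? xs ≡ count P? (filter Q? xs) + count P? (filter (¬? ∘ Q?) xs)
  count-split [] = refl
  count-split (x ∷ xs) with Q? x | P? x in eq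
  ... | yes _ | yes _ rewrite eq = cong suc (count-split xs)
  ... | yes _ | no _  rewrite eq = count-split xs
  ... | no _  | yes _ rewrite eq = trans (cong suc (count-split xs)) (sym (+-suc _ _))
  ... | no _  | no _  rewrite eq = count-split xs

  length-cover : ∀ xs → All (λ x → P x ⊎ Q x) xs → length xs ≤ count P? xs + count Q? xs
  length-cover [] [] = z≤n
  length-cover (x ∷ xs) (pq ∷ pqs) with P? x | Q? x
  ... | yes _ | yes _ = s≤s (≤-trans (length-cover xs pqs) (+-monoʳ-≤ _ (m≤n⇒m≤1+n ≤-refl)))
  ... | yes _ | no _  = s≤s (length-cover xs pqs)
  ... | no _  | yes _ = ≤-trans (s≤s (length-cover xs pqs)) (≤-reflexive (sym (+-suc _ _)))
  ... | no ¬p | no ¬q = contradiction pq [ ¬p , ¬q ]′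

length-complement : ∀ {A : Set} {P : A → Set} (P? : Decidable P) xs →
  length xs ≤ count P? xs + count (¬? ∘ P?) xs
length-complement P? xs = length-cover P? (¬? ∘ P?) xs (All.tabulate λ {x} _ → either (P? x))
  where
  either : ∀ {X : Set} → Dec X → X ⊎ ¬ X
  either (yes x) = inj₁ x
  either (no ¬x) = inj₂ ¬x

count-none : ∀ {A : Set} {P : A → Set} (P? : Decidable P) {xs} → (∀ {x} → x ∈ xs → ¬ P x) → count P? xs ≡ 0
count-none P? none = cong length (filter-none P? (All.tabulate none))

-- The extremal function.

capacity : ℕ → ℕ
capacity 0 = 1
capacity 1 = 2
capacity (suc (suc s)) = 5 * capacity s

capacity-pos : ∀ s → 1 ≤ capacity s
capacity-pos 0 = ≤-refl
capacity-pos 1 = s≤s z≤n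
capacity-pos (suc (suc s)) = ≤-trans (capacity-pos s) (m≤m+n _ _)

-- Serves the case of a monochromatic cut, whose two sides both have one color fewer.
capacity-double : ∀ s → capacity s + capacity s ≤ capacity (suc s)
capacity-double 0 = ≤-refl
capacity-double 1 = s≤s (s≤s (s≤s (s≤s z≤n)))
capacity-double (suc (suc s)) = begin
  5 * capacity s + 5 * capacity s ≡⟨ distrib (capacity s) ⟩
  5 * (capacity s + capacity s)   ≤⟨ *-monoʳ-≤ 5 (capacity-double s) ⟩
  5 * capacity (suc s)            ∎
  where
  open ≤-Reasoning
  distrib : ∀ n → 5 * n + 5 * n ≡ 5 * (n + n)
  distrib = solve-∀

-- Shows that a cut is never tight for `suc h * 2` colors: its two sides hold at most
-- `4 * capacity (h * 2)` vertices out of `5 * capacity (h * 2)`.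
capacity-odd : ∀ h → capacity (suc (h * 2)) ≡ 2 * capacity (h * 2)
capacity-odd zero = refl
capacity-odd (suc h) = trans (cong (5 *_) (capacity-odd h)) (rearrange (capacity (h * 2)))
  where
  rearrange : ∀ n → 5 * (2 * n) ≡ 2 * (5 * n)
  rearrange = solve-∀

-- Giving every loop the extra color ∅ makes symmetry and the absence of rainbow triangles
-- hold for all vertices, distinct or not, and lets c decide equality of vertices.
module LoopColored {A C : Set} (_≟_ : DecidableEquality C) (∅ : C) (c : A → A → C)
  (c-loop : ∀ u → c u u ≡ ∅) (c-∅ : ∀ {u v} → c u v ≡ ∅ → u ≡ v)
  (c-sym : ∀ u v → c u v ≡ c v u)
  (gallai : ∀ u v w → c u v ≡ c u w ⊎ c v w ≡ c u v ⊎ c v w ≡ c u w) where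

  -- Gallai's theorem.

  _≟ᵛ_ : DecidableEquality A
  u ≟ᵛ v = map′ c-∅ (λ { refl → c-loop u }) (c u v ≟ ∅)

  OneOf : C → C → C → Set
  OneOf a b d = d ≡ a ⊎ d ≡ b

  oneOf? : ∀ a b d → Dec (OneOf a b d)
  oneOf? a b d = (d ≟ a) ⊎-dec (d ≟ b)

  -- label a b xs names the connected components on xs of the graph formed by the edges
  -- colored neither a nor b.
  module Components (a b : C) where

    JoinsVia : (A → A) → A → List A → A → Set
    JoinsVia ℓ v xs u = u ≡ v ⊎ Any (λ w → ℓ w ≡ ℓ u × ¬ OneOf a b (c v w)) xs

    joinsVia? : ∀ ℓ v xs → Decidable (JoinsVia ℓ v xs)
    joinsVia? ℓ v xs u = (u ≟ᵛ v) ⊎-dec Any.any? (λ w → (ℓ w ≟ᵛ ℓ u) ×-dec ¬? (oneOf? a b (c v w))) xs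

    abstract
      label : List A → A → A
      label []       u = u
      label (v ∷ xs) u with joinsVia? (label xs) v xs u
      ... | yes _ = v
      ... | no  _ = label xs u

    Joins : A → List A → A → Set
    Joins v xs = JoinsVia (label xs) v xs

    joins? : ∀ v xs → Decidable (Joins v xs)
    joins? v xs = joinsVia? (label xs) v xs

    abstract
      label-joined : ∀ {v xs u} → Joins v xs u → label (v ∷ xs) u ≡ v
      label-joined {v} {xs} {u} j with joinsVia? (label xs) v xs u
      ... | yes _ = refl
      ... | no ¬j = contradiction j ¬j

      label-unjoined : ∀ {v xs u} → ¬ Joins v xs u → label (v ∷ xs) u ≡ label xs u
      label-unjoined {v} {xs} {u} ¬j with joinsVia? (label xs) v xs u
      ... | yes j = contradiction j ¬j
      ... | no _  = refl

    ∈-tail : ∀ {v u : A} {xs} → u ∈ v ∷ xs → u ≢ v → u ∈ xs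
    ∈-tail (here u≡v)  u≢v = contradiction u≡v u≢v
    ∈-tail (there u∈) _   = u∈

    abstract
      label-∈ : ∀ {xs u} → u ∈ xs → label xs u ∈ xs
      label-∈ {v ∷ xs} {u} u∈ with joinsVia? (label xs) v xs u
      ... | yes _ = here refl
      ... | no ¬j = there (label-∈ (∈-tail u∈ (¬j ∘ inj₁)))

    -- An edge from `v` to `w` outside `a` and `b` would join `w`. If `u` is not `v`, its old
    -- component meets `v`, and `w` would be joined if it lay in that component; so the old
    -- separation applies.
    joined-separates : ∀ {v xs} → (∀ {u w} → u ∈ xs → w ∈ xs → label xs u ≢ label xs w → OneOf a b (c u w)) →
      ∀ {u w} → u ∈ v ∷ xs → Joins v xs u → w ∈ xs → ¬ Joins v xs w → OneOf a b (c u w)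
    joined-separates {v} separates {u} {w} u∈ j w∈ ¬k with oneOf? a b (c u w) | u ≟ᵛ v
    ... | yes ab | _ = ab
    ... | no ¬ab | yes refl = contradiction (inj₂ (lose w∈ (refl , ¬ab))) ¬k
    ... | no ¬ab | no u≢v with j
    ...   | inj₁ u≡v = contradiction u≡v u≢v
    ...   | inj₂ any = separates (∈-tail u∈ u≢v) w∈
      (λ u~w → ¬k (inj₂ (Any.map (λ { (t~u , ¬ab) → trans t~u u~w , ¬ab }) any)))

    abstract
      label-separates : ∀ {xs u w} → u ∈ xs → w ∈ xs → label xs u ≢ label xs w → OneOf a b (c u w)
      label-separates {v ∷ xs} {u} {w} u∈ w∈ u≁w with joinsVia? (label xs) v xs u | joinsVia? (label xs) v xs w
      ... | yes _ | yes _ = contradiction refl u≁w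
      ... | no ¬j | no ¬k =
        label-separates (∈-tail u∈ (¬j ∘ inj₁)) (∈-tail w∈ (¬k ∘ inj₁)) u≁w
      ... | yes j | no ¬k = joined-separates label-separates u∈ j (∈-tail w∈ (¬k ∘ inj₁)) ¬k
      ... | no ¬j | yes k = subst (OneOf a b) (c-sym w u)
        (joined-separates label-separates w∈ k (∈-tail u∈ (¬j ∘ inj₁)) ¬j)

    Invariant : List A → (A → Set) → Set
    Invariant xs P = ∀ {u w} → u ∈ xs → w ∈ xs → ¬ OneOf a b (c u w) → P u → P w

    abstract
      -- Induction along connecting paths, without paths as objects: what every edge outside `a` and
      -- `b` preserves is preserved throughout a component.
      label-invariant : ∀ {xs P} → Unique xs → Invariant xs P →
        ∀ {u w} → u ∈ xs → w ∈ xs → label xs u ≡ label xs w → P u → P w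
      label-invariant {v ∷ xs} {P} uniq@(_ ∷ uniq′) inv {u} {w} u∈ w∈ u~w pu
        with joinsVia? (label xs) v xs u | joinsVia? (label xs) v xs w
      ... | no ¬j | no ¬k = label-invariant uniq′ (λ s∈ t∈ → inv (there s∈) (there t∈))
                              (∈-tail u∈ (¬j ∘ inj₁)) (∈-tail w∈ (¬k ∘ inj₁)) u~w pu
      ... | no ¬j | yes _ = contradiction
        (subst (_∈ xs) u~w (label-∈ (∈-tail u∈ (¬j ∘ inj₁)))) (Unique[x∷xs]⇒x∉xs uniq)
      ... | yes _ | no ¬k = contradiction
        (subst (_∈ xs) (sym u~w) (label-∈ (∈-tail w∈ (¬k ∘ inj₁)))) (Unique[x∷xs]⇒x∉xs uniq)
      ... | yes j | yes k = from-v w∈ k (to-v u∈ j pu)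
        where
        inv′ : Invariant xs P
        inv′ s∈ t∈ = inv (there s∈) (there t∈)
        to-v : ∀ {t} → t ∈ v ∷ xs → Joins v xs t → P t → P v
        to-v _          (inj₁ refl) pt = pt
        to-v (here refl) (inj₂ _)   pt = pt
        to-v (there t∈) (inj₂ any)  pt with find any
        ... | s , s∈ , s~t , ¬ab = inv (there s∈) (here refl) (¬ab ∘ subst (OneOf a b) (c-sym s v))
          (label-invariant uniq′ inv′ t∈ s∈ (sym s~t) pt)
        from-v : ∀ {t} → t ∈ v ∷ xs → Joins v xs t → P v → P t
        from-v _          (inj₁ refl) pv = pv
        from-v (here refl) (inj₂ _)   pv = pv
        from-v (there t∈) (inj₂ any)  pv with find any
        ... | s , s∈ , s~t , ¬ab = label-invariant uniq′ inv′ s∈ t∈ s~t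
          (inv (here refl) (there s∈) ¬ab pv)

    -- Let `p q` be an edge inside a component, colored neither `a` nor `b`. The edges from an
    -- outside vertex `u` to `p` and `q` have colors among `a` and `b`, so the triangle is not
    -- rainbow only if these two agree. This spreads over the component.
    label-module : ∀ {xs u s t} → Unique xs → u ∈ xs → s ∈ xs → t ∈ xs →
      label xs s ≡ label xs t → label xs u ≢ label xs s → c u s ≡ c u t
    label-module {xs} {u} {s} {t} uniq u∈ s∈ t∈ s~t u≁s =
      sym (proj₂ (label-invariant uniq inv s∈ t∈ s~t (u≁s , refl)))
      where
      P : A → Set
      -- The first factor keeps `u` outside the component, so that `label-separates` applies at
      -- every step.
      P r = label xs u ≢ label xs r × c u r ≡ c u s
      inv : Invariant xs P
      inv {p} {q} p∈ q∈ ¬ab (u≁p , cup) with label xs p ≟ᵛ label xs q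
      ... | no p≁q = contradiction (label-separates p∈ q∈ p≁q) ¬ab
      ... | yes p~q with gallai u p q
      ...   | inj₁ e = (λ u~q → u≁p (trans u~q (sym p~q))) , trans (sym e) cup
      ...   | inj₂ (inj₁ e) = contradiction (subst (OneOf a b) (sym e) (label-separates u∈ p∈ u≁p)) ¬ab
      ...   | inj₂ (inj₂ e) = contradiction (subst (OneOf a b) (sym e)
        (label-separates u∈ q∈ (λ u~q → u≁p (trans u~q (sym p~q))))) ¬ab

    label-isolated : ∀ {v xs u} → Unique (v ∷ xs) → All (OneOf a b ∘ c v) xs → u ∈ xs →
      label (v ∷ xs) v ≢ label (v ∷ xs) u
    label-isolated {v} {xs} {u} uniq all u∈ v~u =
      v∉ (subst (_∈ xs) (trans (sym (label-unjoined ¬j)) (trans (sym v~u) (label-joined (inj₁ refl)))) (label-∈ u∈))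
      where
      v∉ = Unique[x∷xs]⇒x∉xs uniq
      ¬j : ¬ Joins v xs u
      ¬j (inj₁ refl) = v∉ u∈
      ¬j (inj₂ any) with find any
      ... | s , s∈ , _ , ¬ab = ¬ab (All.lookup all s∈)

  open Components

  Splits : C → C → List A → Set
  Splits a b xs = ∃₂ λ u w → u ∈ xs × w ∈ xs × label a b xs u ≢ label a b xs w

  other-component : ∀ {a b xs t} → Splits a b xs → t ∈ xs →
    ∃ λ s → s ∈ xs × label a b xs s ≢ label a b xs t
  other-component {a} {b} {xs} {t} (u , w , u∈ , w∈ , u≁w) t∈ with label a b xs u ≟ᵛ label a b xs t
  ... | no u≁t = u , u∈ , u≁t
  ... | yes u~t = w , w∈ , λ w~t → u≁w (trans u~t (sym w~t))

  -- The case in which a new vertex v joins every component: then v sees only one color x other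
  -- than a and b, and only one of a and b, because every vertex t with c v t ∈ {a , b} sees
  -- the other components in color c v t.
  module _ {a b : C} {v : A} {xs : List A} (uniq : Unique xs) (split : Splits a b xs)
           (joined : ∀ {u} → u ∈ xs → Any (λ w → label a b xs w ≡ label a b xs u × ¬ OneOf a b (c v w)) xs)
           where

    private
      _~_ _≁_ : A → A → Set
      u ~ w = label a b xs u ≡ label a b xs w
      u ≁ w = ¬ (u ~ w)

      other : ∀ {t} → t ∈ xs → ∃ λ s → s ∈ xs × s ≁ t
      other = other-component split

      other-colors-across : ∀ {s t} → s ∈ xs → t ∈ xs → s ≁ t →
        ¬ OneOf a b (c v s) → ¬ OneOf a b (c v t) → c v s ≡ c v t
      other-colors-across {s} {t} s∈ t∈ s≁t ¬s ¬t with gallai v s t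
      ... | inj₁ e = e
      ... | inj₂ (inj₁ e) = contradiction (subst (OneOf a b) e (label-separates a b s∈ t∈ s≁t)) ¬s
      ... | inj₂ (inj₂ e) = contradiction (subst (OneOf a b) e (label-separates a b s∈ t∈ s≁t)) ¬t

      other-colors : ∀ {s t} → s ∈ xs → t ∈ xs →
        ¬ OneOf a b (c v s) → ¬ OneOf a b (c v t) → c v s ≡ c v t
      other-colors {s} {t} s∈ t∈ ¬s ¬t with label a b xs s ≟ᵛ label a b xs t
      ... | no s≁t = other-colors-across s∈ t∈ s≁t ¬s ¬t
      ... | yes s~t with other s∈
      ...   | r , r∈ , r≁s with find (joined r∈)
      -- Two vertices of one component are compared through `r′` in another component, which `v`
      -- also sees in a color other than `a` and `b`.
      ...     | r′ , r′∈ , r′~r , ¬r′ = trans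
        (other-colors-across s∈ r′∈ (λ s~r′ → r≁s (sym (trans s~r′ r′~r))) ¬s ¬r′)
        (other-colors-across r′∈ t∈ (λ r′~t → r≁s (trans (sym r′~r) (trans r′~t (sym s~t)))) ¬r′ ¬t)

      -- Some `s′` in the component of `s` has `c v s′` outside `a` and `b`, while `v t` and `t s′`
      -- have colors among them. The triangle `v t s′` makes the latter two equal, and
      -- `label-module` moves from `s′` to `s`.
      forced : ∀ {s t} → s ∈ xs → t ∈ xs → s ≁ t → OneOf a b (c v t) → c t s ≡ c v t
      forced {s} {t} s∈ t∈ s≁t ab with find (joined s∈)
      ... | s′ , s′∈ , s′~s , ¬s′ with gallai v t s′
      ...   | inj₁ e = contradiction (subst (OneOf a b) e ab) ¬s′
      ...   | inj₂ (inj₁ e) = trans (label-module a b uniq t∈ s∈ s′∈ (sym s′~s) (s≁t ∘ sym)) e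
      ...   | inj₂ (inj₂ e) = contradiction (subst (OneOf a b) e
        (label-separates a b t∈ s′∈ (λ t~s′ → s≁t (sym (trans t~s′ s′~s))))) ¬s′

      ab-colors : ∀ {s t} → s ∈ xs → t ∈ xs → OneOf a b (c v s) → OneOf a b (c v t) → c v s ≡ c v t
      ab-colors {s} {t} s∈ t∈ abs abt with label a b xs s ≟ᵛ label a b xs t
      ... | no s≁t = trans (sym (forced t∈ s∈ (s≁t ∘ sym) abs)) (trans (c-sym s t) (forced s∈ t∈ s≁t abt))
      ... | yes s~t with other s∈
      ...   | r , r∈ , r≁s = begin
        c v s ≡⟨ forced r∈ s∈ r≁s abs ⟨
        c s r ≡⟨ c-sym s r ⟩
        c r s ≡⟨ label-module a b uniq r∈ s∈ t∈ s~t r≁s ⟩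
        c r t ≡⟨ c-sym r t ⟩
        c t r ≡⟨ forced r∈ t∈ (λ r~t → r≁s (trans r~t (sym s~t))) abt ⟩
        c v t ∎
        where open ≡-Reasoning

    joined-two-colors : ∀ {u} → u ∈ xs → ∃₂ λ a′ b′ → All (OneOf a′ b′ ∘ c v) xs
    joined-two-colors u∈ with find (joined u∈) | Any.any? (oneOf? a b ∘ c v) xs
    -- No edge at `v` has color `a` or `b`, so a single color remains and fills both places.
    ... | s , s∈ , _ , ¬s | no none = c v s , c v s , All.tabulate λ t∈ →
      inj₁ (other-colors t∈ s∈ (λ ab → none (lose t∈ ab)) ¬s)
    ... | s , s∈ , _ , ¬s | yes some with find some
    ...   | r , r∈ , abr = c v r , c v s , All.tabulate λ {t} t∈ → classify t∈ (oneOf? a b (c v t))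
      where
      classify : ∀ {t} → t ∈ xs → Dec (OneOf a b (c v t)) → OneOf (c v r) (c v s) (c v t)
      classify t∈ (yes abt) = inj₁ (ab-colors t∈ r∈ abt abr)
      classify t∈ (no ¬t)   = inj₂ (other-colors t∈ s∈ ¬t ¬s)

  -- If `v` joins every component, the two colors at `v` replace `a` and `b`, and `v` becomes a
  -- component of its own. Otherwise some component stays apart from `v` and the pair is kept.
  extend-splitting : ∀ {a b v xs} → Unique (v ∷ xs) → Splits a b xs → ∃₂ λ a′ b′ → Splits a′ b′ (v ∷ xs)
  extend-splitting {a} {b} {v} {xs} uniq@(_ ∷ uniq′) split@(t , _ , t∈ , _)
    with All.all? (joins? a b v xs) xs
  ... | yes all with joined-two-colors uniq′ split
                       (λ u∈ → [ (λ { refl → contradiction u∈ (Unique[x∷xs]⇒x∉xs uniq) }) , (λ x → x) ]′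
                                 (All.lookup all u∈)) t∈
  ...   | a′ , b′ , two = a′ , b′ , v , t , here refl , there t∈ , label-isolated a′ b′ uniq two t∈
  extend-splitting {a} {b} {v} {xs} uniq split | no ¬all
    with find (¬All⇒Any¬ (joins? a b v xs) xs ¬all)
  ... | u , u∈ , ¬j = a , b , v , u , here refl , there u∈ , λ v~u →
    Unique[x∷xs]⇒x∉xs uniq (subst (_∈ xs)
      (trans (sym (label-unjoined a b ¬j)) (trans (sym v~u) (label-joined a b (inj₁ refl))))
      (label-∈ a b u∈))

  gallai-partition : ∀ {v w xs} → Unique (v ∷ w ∷ xs) → ∃₂ λ a b → Splits a b (v ∷ w ∷ xs)
  gallai-partition {v} {w} {[]} uniq = c v w , c v w , v , w , here refl , there (here refl) ,
    label-isolated _ _ uniq (inj₁ refl ∷ []) (here refl)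
  gallai-partition {xs = _ ∷ _} uniq@(_ ∷ uniq′) with gallai-partition uniq′
  ... | _ , _ , split = extend-splitting uniq split

  -- Colorings without monochromatic triangles and their structure.

  -- Loops have color `∅`, so `d ≢ ∅` already makes the three vertices distinct.
  MonoFree : List A → Set
  MonoFree xs = ∀ {u v w d} → u ∈ xs → v ∈ xs → w ∈ xs → d ≢ ∅ →
    c u v ≡ d → c u w ≡ d → c v w ≢ d

  ColorsIn : List C → List A → Set
  ColorsIn S xs = ∀ {u w} → u ∈ xs → w ∈ xs → u ≢ w → c u w ∈ S

  record Valid (S : List C) (xs : List A) : Set where
    constructor valid
    field
      unique   : Unique xs
      monoFree : MonoFree xs
      colorsIn : ColorsIn S xs
  open Valid

  filter-valid : ∀ {S xs} {P : A → Set} (P? : Decidable P) → Valid S xs → Valid S (filter P? xs)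
  filter-valid {S} {xs} P? v = valid (filter⁺ P? (unique v))
    (λ u∈ v∈ w∈ → monoFree v (inc u∈) (inc v∈) (inc w∈)) (λ u∈ w∈ → colorsIn v (inc u∈) (inc w∈))
    where
    inc : ∀ {u} → u ∈ filter P? xs → u ∈ xs
    inc = proj₁ ∘ ∈-filter⁻ P?

  remove : C → List C → List C
  remove d = filter (λ e → ¬? (e ≟ d))

  ∈-remove : ∀ {d e S} → e ∈ S → e ≢ d → e ∈ remove d S
  ∈-remove = ∈-filter⁺ (λ e → ¬? (e ≟ _))

  length-remove : ∀ {d S s} → d ∈ S → length S ≤ suc s → length (remove d S) ≤ s
  length-remove {d} {S} d∈ S≤ = s≤s⁻¹ (≤-trans
    (filter-notAll (λ e → ¬? (e ≟ d)) S (Any.map (λ { refl ¬refl → ¬refl refl }) d∈)) S≤)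

  remove-valid : ∀ {d S xs} → (∀ {u w} → u ∈ xs → w ∈ xs → c u w ≢ d) → Valid S xs → Valid (remove d S) xs
  remove-valid no-d v = valid (unique v) (monoFree v)
    λ u∈ w∈ u≢w → ∈-remove (colorsIn v u∈ w∈ u≢w) (no-d u∈ w∈)

  record TwoColored (a b : C) (xs : List A) : Set where
    field
      part     : A → A
      separate : ∀ {u w} → u ∈ xs → w ∈ xs → part u ≢ part w → OneOf a b (c u w)
      modular  : ∀ {u s t} → u ∈ xs → s ∈ xs → t ∈ xs → part s ≡ part t → part u ≢ part s → c s u ≡ c t u
      sees-a   : ∀ {p} → p ∈ xs → ∃ λ q → q ∈ xs × part q ≢ part p × c p q ≡ a
      sees-b   : ∀ {p} → p ∈ xs → ∃ λ q → q ∈ xs × part q ≢ part p × c p q ≡ b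

  -- The two cases of the later inductions: without monochromatic triangles, a cut takes one color
  -- away from both sides, and a two-colored partition takes two colors away from each part.
  data Structure (xs : List A) : Set₁ where
    cut : ∀ {d p q} {P : A → Set} → Decidable P → p ∈ xs → P p → q ∈ xs → ¬ P q →
      (∀ {u w} → u ∈ xs → w ∈ xs → P u → ¬ P w → c u w ≡ d) → Structure xs
    twoColored : ∀ {a b} → a ≢ b → TwoColored a b xs → Structure xs

  structure : ∀ {v w xs} → Unique (v ∷ w ∷ xs) → Structure (v ∷ w ∷ xs)
  structure {v} {w} {zs} uniq with gallai-partition uniq
  ... | a , b , split = go
    where
    xs : List A
    xs = v ∷ w ∷ zs
    ℓ : A → A
    ℓ = label a b xs

    -- If `p` sees only `d` outside its part, then by modularity so does its whole part, and that
    -- part against the rest is a monochromatic cut.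
    cut-at : ∀ {d p} → p ∈ xs → (∀ {q} → q ∈ xs → ℓ q ≢ ℓ p → c p q ≡ d) → Structure xs
    cut-at {d} {p} p∈ sees-d with other-component split p∈
    ... | q , q∈ , q≁p = cut (λ u → ℓ u ≟ᵛ ℓ p) p∈ refl q∈ q≁p λ {u} {r} u∈ r∈ u~p r≁p → begin
      c u r ≡⟨ c-sym u r ⟩
      c r u ≡⟨ label-module a b uniq r∈ u∈ p∈ u~p (λ r~u → r≁p (trans r~u u~p)) ⟩
      c r p ≡⟨ c-sym r p ⟩
      c p r ≡⟨ sees-d r∈ r≁p ⟩
      d     ∎
      where open ≡-Reasoning

    across : ∀ {p q} → p ∈ xs → q ∈ xs → ℓ q ≢ ℓ p → OneOf a b (c p q)
    across p∈ q∈ q≁p = label-separates a b p∈ q∈ (q≁p ∘ sym)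

    Sees : C → A → Set
    Sees d p = Any (λ q → ℓ q ≢ ℓ p × c p q ≡ d) xs

    sees? : ∀ d → Decidable (Sees d)
    sees? d p = Any.any? (λ q → ¬? (ℓ q ≟ᵛ ℓ p) ×-dec (c p q ≟ d)) xs

    go : Structure xs
    go with a ≟ b | All.all? (sees? a) xs | All.all? (sees? b) xs
    ... | yes refl | _ | _ = cut-at (here refl) λ q∈ q≁p → [ (λ e → e) , (λ e → e) ]′ (across (here refl) q∈ q≁p)
    ... | no _ | no ¬all | _ with find (¬All⇒Any¬ (sees? a) xs ¬all)
    ...   | p , p∈ , ¬sees = cut-at p∈ λ q∈ q≁p →
      [ (λ e → contradiction (lose q∈ (q≁p , e)) ¬sees) , (λ e → e) ]′ (across p∈ q∈ q≁p)
    go | no _ | yes _ | no ¬all with find (¬All⇒Any¬ (sees? b) xs ¬all)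
    ...   | p , p∈ , ¬sees = cut-at p∈ λ q∈ q≁p →
      [ (λ e → e) , (λ e → contradiction (lose q∈ (q≁p , e)) ¬sees) ]′ (across p∈ q∈ q≁p)
    go | no a≢b | yes all-a | yes all-b = twoColored a≢b record
      { part     = ℓ
      ; separate = label-separates a b
      ; modular  = λ {u} {s} {t} u∈ s∈ t∈ s~t u≁s →
          trans (c-sym s u) (trans (label-module a b uniq u∈ s∈ t∈ s~t u≁s) (c-sym u t))
      ; sees-a   = λ p∈ → find (All.lookup all-a p∈)
      ; sees-b   = λ p∈ → find (All.lookup all-b p∈)
      }

  module _ {S xs} (v : Valid S xs) where

    -- An edge of color `d` inside one side would form a monochromatic triangle with any vertex of
    -- the other side, and both sides are inhabited.
    cut-valid : ∀ {d p q} {P : A → Set} (P? : Decidable P) → p ∈ xs → P p → q ∈ xs → ¬ P q →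
      (∀ {u w} → u ∈ xs → w ∈ xs → P u → ¬ P w → c u w ≡ d) →
      d ∈ S × Valid (remove d S) (filter P? xs) × Valid (remove d S) (filter (¬? ∘ P?) xs)
    cut-valid {d} {p} {q} {P} P? p∈ Pp q∈ ¬Pq across =
      subst (_∈ S) d≡ (colorsIn v p∈ q∈ p≢q) ,
      remove-valid (λ u∈ w∈ → no-d-in (∈-filter⁻ P? u∈) (∈-filter⁻ P? w∈)) (filter-valid P? v) ,
      remove-valid (λ u∈ w∈ → no-d-out (∈-filter⁻ (¬? ∘ P?) u∈) (∈-filter⁻ (¬? ∘ P?) w∈))
        (filter-valid (¬? ∘ P?) v)
      where
      d≡ : c p q ≡ d
      d≡ = across p∈ q∈ Pp ¬Pq
      p≢q : p ≢ q
      p≢q p≡q = ¬Pq (subst P p≡q Pp)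
      d≢∅ : d ≢ ∅
      d≢∅ d≡∅ = p≢q (c-∅ (trans d≡ d≡∅))
      no-d-in : ∀ {u w} → u ∈ xs × P u → w ∈ xs × P w → c u w ≢ d
      no-d-in (u∈ , Pu) (w∈ , Pw) e =
        monoFree v u∈ w∈ q∈ d≢∅ e (across u∈ q∈ Pu ¬Pq) (across w∈ q∈ Pw ¬Pq)
      no-d-out : ∀ {u w} → u ∈ xs × ¬ P u → w ∈ xs × ¬ P w → c u w ≢ d
      no-d-out (u∈ , ¬Pu) (w∈ , ¬Pw) =
        monoFree v p∈ u∈ w∈ d≢∅ (across p∈ u∈ Pp ¬Pu) (across p∈ w∈ Pp ¬Pw)

  flip : ∀ {a b xs} → TwoColored a b xs → TwoColored b a xs
  flip t = record
    { part     = part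
    ; separate = λ u∈ w∈ u≁w → [ inj₂ , inj₁ ]′ (separate u∈ w∈ u≁w)
    ; modular  = modular
    ; sees-a   = sees-b
    ; sees-b   = sees-a
    }
    where open TwoColored t

  module _ {a b S xs} (v : Valid S xs) (t : TwoColored a b xs) where
    open TwoColored t

    sees-proper : ∀ {d p q} → part q ≢ part p → c p q ≡ d → d ≢ ∅
    sees-proper q≁p e refl = q≁p (cong part (sym (c-∅ e)))

    a∈S : ∀ {p} → p ∈ xs → a ∈ S
    a∈S p∈ with sees-a p∈
    ... | q , q∈ , q≁p , e = subst (_∈ S) e (colorsIn v p∈ q∈ λ p≡q → q≁p (cong part (sym p≡q)))

    -- `u` has an `a`-neighbor `q` outside the part. By modularity `w q` has color `a` too, so `u w`
    -- of color `a` would close a triangle.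
    a-not-in-part : ∀ {u w} → u ∈ xs → w ∈ xs → part u ≡ part w → c u w ≢ a
    a-not-in-part u∈ w∈ u~w e with sees-a u∈
    ... | q , q∈ , q≁u , uq = monoFree v u∈ w∈ q∈ (sees-proper q≁u uq) e uq
      (trans (sym (modular q∈ u∈ w∈ u~w q≁u)) uq)

    -- The part of one a-neighbor q of p, and the other a-neighbors of p: those are joined to q,
    -- and among different parts, in color b only, so they lie in a single part.
    a-neighbors-parts : ∀ {p} → p ∈ xs → ∃ λ q → q ∈ xs ×
      ∀ {r s} → r ∈ xs → s ∈ xs → part r ≢ part q → part s ≢ part q → c p r ≡ a → c p s ≡ a → part r ≡ part s
    a-neighbors-parts {p} p∈ with sees-a p∈
    ... | q , q∈ , q≁p , pq = q , q∈ , same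
      where
      a≢∅ : a ≢ ∅
      a≢∅ = sees-proper q≁p pq
      qb : ∀ {r} → r ∈ xs → part r ≢ part q → c p r ≡ a → c q r ≡ b
      qb r∈ r≁q pr with separate q∈ r∈ (r≁q ∘ sym)
      ... | inj₁ e = contradiction e (monoFree v p∈ q∈ r∈ a≢∅ pq pr)
      ... | inj₂ e = e
      same : ∀ {r s} → r ∈ xs → s ∈ xs → part r ≢ part q → part s ≢ part q → c p r ≡ a → c p s ≡ a → part r ≡ part s
      same {r} {s} r∈ s∈ r≁q s≁q pr ps with part r ≟ᵛ part s
      ... | yes r~s = r~s
      ... | no r≁s with separate r∈ s∈ r≁s
      ...   | inj₁ e = contradiction e (monoFree v p∈ r∈ s∈ a≢∅ pr ps)
      ...   | inj₂ e = contradiction e (monoFree v q∈ r∈ s∈ (sees-proper r≁q (qb r∈ r≁q pr)) (qb r∈ r≁q pr) (qb s∈ s≁q ps))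

  module _ {a b S xs} (v : Valid S xs) (t : TwoColored a b xs) where
    open TwoColored t

    in-part-valid : ∀ {ys} → Valid S ys → (∀ {u} → u ∈ ys → u ∈ xs) →
      (∀ {u w} → u ∈ ys → w ∈ ys → part u ≡ part w) → Valid (remove b (remove a S)) ys
    in-part-valid vy inc same =
      remove-valid (λ u∈ w∈ → a-not-in-part v (flip t) (inc u∈) (inc w∈) (same u∈ w∈))
      (remove-valid (λ u∈ w∈ → a-not-in-part v t (inc u∈) (inc w∈) (same u∈ w∈)) vy)

    own-part : A → List A
    own-part p = filter (λ u → part u ≟ᵛ part p) xs

    ∈-own-part : ∀ {p u} → u ∈ own-part p → u ∈ xs × part u ≡ part p
    ∈-own-part {p} = ∈-filter⁻ (λ u → part u ≟ᵛ part p)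

    own-part-valid : ∀ p → Valid (remove b (remove a S)) (own-part p)
    own-part-valid p = in-part-valid (filter-valid (λ u → part u ≟ᵛ part p) v) (proj₁ ∘ ∈-own-part)
      λ u∈ w∈ → trans (proj₂ (∈-own-part u∈)) (sym (proj₂ (∈-own-part w∈)))

  -- Degree bounds in the two-colored case.

  neighbors : List A → A → C → List A
  neighbors xs p d = filter (λ u → c p u ≟ d) xs

  module _ {a b S xs} (v : Valid S xs) (t : TwoColored a b xs) {F : ℕ}
           (part-bound : ∀ {ys} → Valid (remove b (remove a S)) ys → length ys ≤ F) where
    open TwoColored t

    -- The `a`-neighbors of `p` occupy at most two parts: that of `q` and one more.
    a-neighbors-bound : ∀ {p} → p ∈ xs → length (neighbors xs p a) ≤ F + F
    a-neighbors-bound {p} p∈ with a-neighbors-parts v t p∈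
    ... | q , q∈ , same = ≤-trans (length-complement P? ns) (+-mono-≤
      (part-bound (in-part-valid v t (filter-valid P? vn) (proj₁ ∘ in-P)
        (λ u∈ w∈ → trans (proj₂ (proj₂ (in-P u∈))) (sym (proj₂ (proj₂ (in-P w∈)))))))
      (part-bound (in-part-valid v t (filter-valid (¬? ∘ P?) vn) (proj₁ ∘ in-¬P)
        (λ u∈ w∈ → let u∈x , pu , u≁q = in-¬P u∈ ; w∈x , pw , w≁q = in-¬P w∈ in same u∈x w∈x u≁q w≁q pu pw))))
      where
      ns = neighbors xs p a
      A? : Decidable (λ u → c p u ≡ a)
      A? u = c p u ≟ a
      P? : Decidable (λ u → part u ≡ part q)
      P? u = part u ≟ᵛ part q
      vn : Valid S ns
      vn = filter-valid A? v
      in-P : ∀ {u} → u ∈ filter P? ns → u ∈ xs × c p u ≡ a × part u ≡ part q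
      in-P u∈ with ∈-filter⁻ P? u∈
      ... | u∈n , u~q with ∈-filter⁻ A? u∈n
      ...   | u∈x , pu = u∈x , pu , u~q
      in-¬P : ∀ {u} → u ∈ filter (¬? ∘ P?) ns → u ∈ xs × c p u ≡ a × part u ≢ part q
      in-¬P u∈ with ∈-filter⁻ (¬? ∘ P?) u∈
      ... | u∈n , u≁q with ∈-filter⁻ A? u∈n
      ...   | u∈x , pu = u∈x , pu , u≁q

  module _ {a b S xs} (v : Valid S xs) (t : TwoColored a b xs) where
    open TwoColored t

    cover : ∀ {p} → p ∈ xs →
      length xs ≤ length (own-part v t p) + (length (neighbors xs p a) + length (neighbors xs p b))
    cover {p} p∈ = ≤-trans (length-complement P? xs) (+-monoʳ-≤ _ (≤-trans
      (length-cover (λ u → c p u ≟ a) (λ u → c p u ≟ b) (filter (¬? ∘ P?) xs)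
        (All.tabulate λ u∈ → let u∈x , u≁p = ∈-filter⁻ (¬? ∘ P?) u∈ in separate p∈ u∈x (u≁p ∘ sym)))
      (+-mono-≤ (fewer a) (fewer b))))
      where
      P? : Decidable (λ u → part u ≡ part p)
      P? u = part u ≟ᵛ part p
      fewer : ∀ d → length (neighbors (filter (¬? ∘ P?) xs) p d) ≤ length (neighbors xs p d)
      fewer d = ≤-trans (m≤n+m _ _) (≤-reflexive (sym (count-split (λ u → c p u ≟ d) P? xs)))

  -- The bound on the number of vertices.

  structure′ : ∀ {xs} → Unique xs → 2 ≤ length xs → Structure xs
  structure′ {_ ∷ []}    _    (s≤s ())
  structure′ {_ ∷ _ ∷ _} uniq _ = structure uniq

  five-parts : ∀ n → n + ((n + n) + (n + n)) ≡ 5 * n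
  five-parts = solve-∀

  nonempty : ∀ {e : C} {S} → e ∈ S → ¬ (length S ≤ 0)
  nonempty e∈ ≤0 = <⇒≱ (∈-length e∈) ≤0

  b∈remove : ∀ {a b S xs p} → a ≢ b → Valid S xs → TwoColored a b xs → p ∈ xs → b ∈ remove a S
  b∈remove a≢b v t p∈ = ∈-remove (a∈S v (flip t) p∈) (a≢b ∘ sym)

  length-remove₂ : ∀ {a b S xs p s} → Valid S xs → TwoColored a b xs → a ≢ b → p ∈ xs →
    length S ≤ suc (suc s) → length (remove b (remove a S)) ≤ s
  length-remove₂ v t a≢b p∈ S≤ = length-remove (b∈remove a≢b v t p∈) (length-remove (a∈S v t p∈) S≤)

  module PartBounds {a b S xs p s F} (v : Valid S xs) (t : TwoColored a b xs) (a≢b : a ≢ b)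
    (S≤ : length S ≤ suc (suc s)) (bound : ∀ {S ys} → length S ≤ s → Valid S ys → length ys ≤ F)
    (p∈ : p ∈ xs) where

    own≤ : length (own-part v t p) ≤ F
    own≤ = bound (length-remove₂ v t a≢b p∈ S≤) (own-part-valid v t p)

    a≤ : length (neighbors xs p a) ≤ F + F
    a≤ = a-neighbors-bound v t (bound (length-remove₂ v t a≢b p∈ S≤)) p∈

    b≤ : length (neighbors xs p b) ≤ F + F
    b≤ = a-neighbors-bound v (flip t) (bound (length-remove₂ v (flip t) (a≢b ∘ sym) p∈ S≤)) p∈

  -- Induction on the number of colors. A cut costs one color and splits into two pieces. A
  -- two-colored partition costs two colors and leaves the part of a vertex, two parts for its
  -- `a`-neighbors and two for its `b`-neighbors.
  length-bound : ∀ s {S xs} → length S ≤ s → Valid S xs → length xs ≤ capacity s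
  length-bound s {xs = []}     _ _ = z≤n
  length-bound s {xs = _ ∷ []} _ _ = capacity-pos s
  length-bound zero {xs = _ ∷ _ ∷ _} S≤ v with structure (unique v)
  ... | cut P? p∈ Pp q∈ ¬Pq across = contradiction S≤ (nonempty (proj₁ (cut-valid v P? p∈ Pp q∈ ¬Pq across)))
  ... | twoColored _ t = contradiction S≤ (nonempty (a∈S v t (here refl)))
  length-bound (suc s) {xs = xs@(_ ∷ _ ∷ _)} S≤ v with structure (unique v)
  length-bound (suc s) {xs = xs} S≤ v | cut P? p∈ Pp q∈ ¬Pq across with cut-valid v P? p∈ Pp q∈ ¬Pq across
  ... | d∈ , vin , vout = ≤-trans (length-complement P? xs) (≤-trans
    (+-mono-≤ (length-bound s (length-remove d∈ S≤) vin) (length-bound s (length-remove d∈ S≤) vout))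
    (capacity-double s))
  length-bound (suc zero) S≤ v | twoColored a≢b t = contradiction
    (length-remove (a∈S v t (here refl)) S≤) (nonempty (b∈remove a≢b v t (here refl)))
  length-bound (suc (suc s)) {xs = xs@(x ∷ _)} S≤ v | twoColored {a} {b} a≢b t = begin
    length xs ≤⟨ cover v t x∈ ⟩
    length (own-part v t x) + (length (neighbors xs x a) + length (neighbors xs x b))
      ≤⟨ +-mono-≤ own≤ (+-mono-≤ a≤ b≤) ⟩
    F + ((F + F) + (F + F)) ≡⟨ five-parts F ⟩
    5 * F ∎
    where
    open ≤-Reasoning
    F = capacity s
    x∈ : x ∈ xs
    x∈ = here refl
    open PartBounds v t a≢b S≤ (length-bound s) x∈

  -- Even degrees in extremal colorings.

  -- The upper bounds on the part of `p` and on its two neighborhoods add up to exactly `length xs`,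
  -- so each is attained.
  module Extremal h {a b S xs p} (v : Valid S xs) (t : TwoColored a b xs) (a≢b : a ≢ b)
    (S≤ : length S ≤ suc h * 2) (len : length xs ≡ 5 * capacity (h * 2)) (p∈ : p ∈ xs) where
    open PartBounds v t a≢b S≤ (length-bound (h * 2)) p∈ public

    private
      F = capacity (h * 2)

    total : F + ((F + F) + (F + F)) ≤
      length (own-part v t p) + (length (neighbors xs p a) + length (neighbors xs p b))
    total = ≤-trans (≤-reflexive (trans (five-parts F) (sym len))) (cover v t p∈)

    own≡ : length (own-part v t p) ≡ F
    own≡ = ≤-antisym own≤ (+-cancelʳ-≤ _ _ _ (≤-trans total (+-monoʳ-≤ (length (own-part v t p)) (+-mono-≤ a≤ b≤))))

    a≡ : length (neighbors xs p a) ≡ F + F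
    a≡ = ≤-antisym a≤ (+-cancelʳ-≤ (F + F) _ _ (+-cancelˡ-≤ F _ _
      (≤-trans total (+-mono-≤ own≤ (+-monoʳ-≤ _ b≤)))))

    b≡ : length (neighbors xs p b) ≡ F + F
    b≡ = ≤-antisym b≤ (+-cancelˡ-≤ (F + F) _ _ (+-cancelˡ-≤ F _ _
      (≤-trans total (+-mono-≤ own≤ (+-monoˡ-≤ _ a≤)))))

    in-own-part : ∀ {d} → d ≢ a → d ≢ b → length (neighbors xs p d) ≡ length (neighbors (own-part v t p) p d)
    in-own-part {d} d≢a d≢b = trans (count-split (λ u → c p u ≟ d) P? xs)
      (trans (cong (length (neighbors (own-part v t p) p d) +_) (count-none (λ u → c p u ≟ d) outside)) (+-identityʳ _))
      where
      open TwoColored t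
      P? : Decidable (λ u → part u ≡ part p)
      P? u = part u ≟ᵛ part p
      outside : ∀ {u} → u ∈ filter (¬? ∘ P?) xs → c p u ≢ d
      outside u∈ refl with ∈-filter⁻ (¬? ∘ P?) u∈
      ... | u∈x , u≁p = [ d≢a , d≢b ]′ (separate p∈ u∈x (u≁p ∘ sym))

    p∈own : p ∈ own-part v t p
    p∈own = ∈-filter⁺ _ p∈ refl

  2∣n+n : ∀ {m} n → m ≡ n + n → 2 ∣ m
  2∣n+n n refl = divides n (double n)
    where
    double : ∀ n → n + n ≡ n * 2
    double = solve-∀

  -- Induction on `h`. A cut would leave too few vertices. In the two-colored case the degrees in
  -- `a` and `b` are twice the size of a part; any other color occurs at `p` only inside its own
  -- part, which is extremal for two colors fewer.
  even-degree : ∀ h {S xs p d} → length S ≤ h * 2 → Valid S xs → length xs ≡ capacity (h * 2) →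
    p ∈ xs → d ≢ ∅ → 2 ∣ length (neighbors xs p d)
  -- A single vertex has only its loop, of color `∅`, so its degree in `d` is zero.
  even-degree zero {xs = x ∷ []} {d = d} _ _ _ (here refl) d≢∅ = subst (2 ∣_)
    (sym (count-none (λ u → c x u ≟ d) {x ∷ []} (λ { (here refl) e → d≢∅ (trans (sym e) (c-loop x)) }))) (2 ∣0)
  even-degree (suc h) {S} {xs} {p} {d} S≤ v len p∈ d≢∅
    with structure′ (unique v) (≤-trans
           (≤-trans (s≤s (s≤s z≤n)) (*-monoʳ-≤ 5 (capacity-pos (h * 2)))) (≤-reflexive (sym len)))
  ... | cut P? p∈ Pp q∈ ¬Pq across with cut-valid v P? p∈ Pp q∈ ¬Pq across
  ...   | d∈ , vin , vout = contradiction too-small (<⇒≱ (F<5F))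
    where
    F = capacity (h * 2)
    F<5F : 4 * F < 5 * F
    F<5F = *-monoˡ-< F {{>-nonZero (capacity-pos (h * 2))}} (≤-refl {5})
    too-small : 5 * F ≤ 4 * F
    too-small = begin
      5 * F     ≡⟨ len ⟨
      length xs ≤⟨ length-complement P? xs ⟩
      _         ≤⟨ +-mono-≤ (length-bound _ (length-remove d∈ S≤) vin) (length-bound _ (length-remove d∈ S≤) vout) ⟩
      capacity (suc (h * 2)) + capacity (suc (h * 2)) ≡⟨ cong (λ n → n + n) (capacity-odd h) ⟩
      2 * F + 2 * F ≡⟨ four F ⟩
      4 * F ∎
      where
      open ≤-Reasoning
      four : ∀ n → 2 * n + 2 * n ≡ 4 * n
      four = solve-∀
  even-degree (suc h) {S} {xs} {p} {d} S≤ v len p∈ d≢∅ | twoColored {a} {b} a≢b t with d ≟ a | d ≟ b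
  ... | yes refl | _ = 2∣n+n (capacity (h * 2)) a≡
    where open Extremal h v t a≢b S≤ len p∈
  ... | no _ | yes refl = 2∣n+n (capacity (h * 2)) b≡
    where open Extremal h v t a≢b S≤ len p∈
  ... | no d≢a | no d≢b = subst (2 ∣_) (sym (in-own-part d≢a d≢b))
    (even-degree h (length-remove₂ v t a≢b p∈ S≤) (own-part-valid v t p) own≡ p∈own d≢∅)
    where open Extremal h v t a≢b S≤ len p∈

-- Counting monochromatic triangles.

unique-⊆-length : ∀ {A : Set} {xs ys : List A} → Unique xs → (∀ {x} → x ∈ xs → x ∈ ys) → length xs ≤ length ys
unique-⊆-length {xs = []} _ _ = z≤n
unique-⊆-length {xs = x ∷ xs} uniq@(_ ∷ uniq′) inc with ∈-∃++ (inc (here refl))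
... | as , bs , refl = ≤-trans (s≤s (unique-⊆-length uniq′ inc′)) (≤-reflexive (begin
  suc (length (as ++ bs))     ≡⟨ cong suc (length-++ as) ⟩
  suc (length as + length bs) ≡⟨ +-suc (length as) (length bs) ⟨
  length as + suc (length bs) ≡⟨ length-++ as ⟨
  length (as ++ x ∷ bs)       ∎))
  where
  open ≡-Reasoning
  inc′ : ∀ {y} → y ∈ xs → y ∈ as ++ bs
  inc′ y∈ with ∈-++⁻ as (inc (there y∈))
  ... | inj₁ y∈as          = ∈-++⁺ˡ y∈as
  ... | inj₂ (here refl)   = contradiction y∈ (Unique[x∷xs]⇒x∉xs uniq)
  ... | inj₂ (there y∈bs) = ∈-++⁺ʳ as y∈bs

count-map : ∀ {A B : Set} {P : B → Set} (P? : Decidable P) (f : A → B) xs →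
  count P? (map f xs) ≡ count (P? ∘ f) xs
count-map P? f [] = refl
count-map P? f (x ∷ xs) with P? (f x)
... | yes _ = cong suc (count-map P? f xs)
... | no _  = count-map P? f xs

count-product : ∀ {A B : Set} {P : A × B → Set} (P? : Decidable P) xs ys →
  count P? (cartesianProduct xs ys) ≡ sum (map (λ x → count (λ y → P? (x , y)) ys) xs)
count-product P? [] ys = refl
count-product P? (x ∷ xs) ys = begin
  length (filter P? (map (x ,_) ys ++ cartesianProduct xs ys))
    ≡⟨ cong length (filter-++ P? (map (x ,_) ys) _) ⟩
  length (filter P? (map (x ,_) ys) ++ filter P? (cartesianProduct xs ys))
    ≡⟨ length-++ (filter P? (map (x ,_) ys)) ⟩
  count P? (map (x ,_) ys) + count P? (cartesianProduct xs ys)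
    ≡⟨ cong₂ _+_ (count-map P? (x ,_) ys) (count-product P? xs ys) ⟩
  _ ∎
  where open ≡-Reasoning

sum-indicator : ∀ {A : Set} {P : A → Set} (P? : Decidable P) {f : A → ℕ} →
  (∀ {x} → P x → f x ≡ 1) → (∀ {x} → ¬ P x → f x ≡ 0) → ∀ xs → sum (map f xs) ≡ count P? xs
sum-indicator P? is-one is-zero [] = refl
sum-indicator P? is-one is-zero (x ∷ xs) with P? x
... | yes p = cong₂ _+_ (is-one p) (sum-indicator P? is-one is-zero xs)
... | no ¬p = cong₂ _+_ (is-zero ¬p) (sum-indicator P? is-one is-zero xs)

Triple : ℕ → Set
Triple n = Fin n × Fin n × Fin n

-- The four tests of `monoIndicator`; the increasing order selects one triple per triangle and
-- implies distinctness.
OrderedMono : ∀ {k n} → Coloring k n → Triple n → Set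
OrderedMono c (i , j , l) = toℕ i < toℕ j × toℕ j < toℕ l × c i j ≡ c j l × c j l ≡ c i l

orderedMono? : ∀ {k n} (c : Coloring k n) → Decidable (OrderedMono c)
orderedMono? c (i , j , l) =
  (toℕ i <? toℕ j) ×-dec (toℕ j <? toℕ l) ×-dec (c i j Finₚ.≟ c j l) ×-dec (c j l Finₚ.≟ c i l)

triples : ∀ n → List (Triple n)
triples n = cartesianProduct (allFin n) (cartesianProduct (allFin n) (allFin n))

∈-triples : ∀ {n} (t : Triple n) → t ∈ triples n
∈-triples (i , j , l) = ∈-cartesianProduct⁺ (∈-allFin i) (∈-cartesianProduct⁺ (∈-allFin j) (∈-allFin l))

triples-unique : ∀ n → Unique (triples n)
triples-unique n = cartesianProduct⁺ (allFin⁺ n) (cartesianProduct⁺ (allFin⁺ n) (allFin⁺ n))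

module _ {k n : ℕ} (c : Coloring k n) where

  indicator-one : ∀ {i j l} → OrderedMono c (i , j , l) → monoIndicator c i j l ≡ 1
  indicator-one {i} {j} {l} (i<j , j<l , ij≡jl , jl≡il)
    with toℕ i <? toℕ j | toℕ j <? toℕ l | c i j Finₚ.≟ c j l | c j l Finₚ.≟ c i l
  ... | yes _  | yes _  | yes _  | yes _  = refl
  ... | yes _  | yes _  | yes _  | no jl≢ = contradiction jl≡il jl≢
  ... | yes _  | yes _  | no ij≢ | _      = contradiction ij≡jl ij≢
  ... | yes _  | no j≮l | _      | _      = contradiction j<l j≮l
  ... | no i≮j | _      | _      | _      = contradiction i<j i≮j

  indicator-zero : ∀ {i j l} → ¬ OrderedMono c (i , j , l) → monoIndicator c i j l ≡ 0
  indicator-zero {i} {j} {l} ¬mono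
    with toℕ i <? toℕ j | toℕ j <? toℕ l | c i j Finₚ.≟ c j l | c j l Finₚ.≟ c i l
  ... | yes p | yes q | yes r | yes s = contradiction (p , q , r , s) ¬mono
  ... | yes _ | yes _ | yes _ | no _  = refl
  ... | yes _ | yes _ | no _  | _     = refl
  ... | yes _ | no _  | _     | _     = refl
  ... | no _  | _     | _     | _     = refl

  -- Turns the nested sum into the length of a duplicate-free list, so that bounds follow from
  -- inclusions between lists.
  numMono≡count : numMono c ≡ count (orderedMono? c) (triples n)
  numMono≡count = sym (trans (count-product (orderedMono? c) (allFin n) _)
    (cong sum (map-cong (λ i → trans (count-product (λ jl → orderedMono? c (i , jl)) (allFin n) (allFin n))
      (cong sum (map-cong (λ j → sym (sum-indicator (λ l → orderedMono? c (i , j , l))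
        indicator-one indicator-zero (allFin n))) (allFin n)))) (allFin n))))

  numMono-≥ : ∀ {ts} → Unique ts → All (OrderedMono c) ts → length ts ≤ numMono c
  numMono-≥ {ts} uniq mono = subst (length ts ≤_) (sym numMono≡count) (unique-⊆-length uniq λ {t} t∈ →
    ∈-filter⁺ (orderedMono? c) (∈-triples t) (All.lookup mono t∈))

-- Triangles are found in arbitrary order but counted in increasing order. The permutation is kept
-- to trace membership of a vertex.
sort₃ : ∀ {n} {u v w : Fin n} → u ≢ v → u ≢ w → v ≢ w →
  ∃ λ i → ∃₂ λ j l → toℕ i < toℕ j × toℕ j < toℕ l × u ∷ v ∷ w ∷ [] ↭ i ∷ j ∷ l ∷ []
sort₃ {n} {u} {v} {w} u≢v u≢w v≢w with order u≢v | order v≢w | order u≢w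
  where
  order : ∀ {x y : Fin n} → x ≢ y → toℕ x < toℕ y ⊎ toℕ y < toℕ x
  order {x} {y} x≢y with <-cmp (toℕ x) (toℕ y)
  ... | tri< x<y _ _ = inj₁ x<y
  ... | tri≈ _ x≡y _ = contradiction (Finₚ.toℕ-injective x≡y) x≢y
  ... | tri> _ _ y<x = inj₂ y<x
... | inj₁ u<v | inj₁ v<w | _        = u , v , w , u<v , v<w , ↭-refl
... | inj₁ u<v | inj₂ w<v | inj₁ u<w = u , w , v , u<w , w<v , prep u (swap v w ↭-refl)
... | inj₁ u<v | inj₂ w<v | inj₂ w<u = w , u , v , w<u , u<v , ↭-trans (prep u (swap v w ↭-refl)) (swap u w ↭-refl)
... | inj₂ v<u | _        | inj₁ u<w = v , u , w , v<u , u<w , swap u v ↭-refl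
... | inj₂ v<u | inj₁ v<w | inj₂ w<u = v , w , u , v<w , w<u , ↭-trans (swap u v ↭-refl) (prep v (swap u w ↭-refl))
... | inj₂ v<u | inj₂ w<v | inj₂ w<u = w , v , u , w<v , v<u ,
  ↭-trans (swap u v ↭-refl) (↭-trans (prep v (swap u w ↭-refl)) (swap v w ↭-refl))

all-equal-unique : ∀ {A : Set} {x : A} {zs} → Unique zs → x ∈ zs → (∀ {z} → z ∈ zs → z ≡ x) → zs ≡ x ∷ []
all-equal-unique {zs = z ∷ []} _ _ eq = cong (_∷ []) (eq (here refl))
all-equal-unique {zs = z ∷ z′ ∷ zs} ((z≢z′ ∷ _) ∷ _) _ eq =
  contradiction (trans (eq (here refl)) (sym (eq (there (here refl))))) z≢z′

another : ∀ {A : Set} {y : A} {zs} → Unique zs → 2 ∣ length zs → y ∈ zs → ∃ λ u → u ∈ zs × u ≢ y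
another {zs = _ ∷ []}     _ 2∣1 _ with () ← ∣1⇒≡1 2∣1
another {zs = z ∷ z′ ∷ _} ((z≢z′ ∷ _) ∷ _) _ (here refl) = z′ , there (here refl) , (z≢z′ ∘ sym)
another {zs = z ∷ _ ∷ _}  uniq _ (there y∈) = z , here refl , λ { refl → Unique[x∷xs]⇒x∉xs uniq y∈ }

-- Gallai colorings as loop-colored ones, with `nothing` for loops.

module GallaiColored {k n : ℕ} (c : Coloring k n) (gallai : Gallai k n c) where

  loopColor : Fin n → Fin n → Maybe (Fin k)
  loopColor u v with u Finₚ.≟ v
  ... | yes _ = nothing
  ... | no _  = just (c u v)

  loopColor-loop : ∀ u → loopColor u u ≡ nothing
  loopColor-loop u with u Finₚ.≟ u
  ... | yes _  = refl
  ... | no u≢u = contradiction refl u≢u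

  loopColor-≢ : ∀ {u v} → u ≢ v → loopColor u v ≡ just (c u v)
  loopColor-≢ {u} {v} u≢v with u Finₚ.≟ v
  ... | yes u≡v = contradiction u≡v u≢v
  ... | no _    = refl

  loopColor-nothing : ∀ {u v} → loopColor u v ≡ nothing → u ≡ v
  loopColor-nothing {u} {v} e with u Finₚ.≟ v
  ... | yes u≡v = u≡v
  ... | no _ with () ← e

  loopColor-just : ∀ {u v d} → loopColor u v ≡ just d → u ≢ v × c u v ≡ d
  loopColor-just {u} {v} e with u Finₚ.≟ v
  ... | yes _ with () ← e
  ... | no u≢v = u≢v , Maybeₚ.just-injective e

  loopColor-sym : ∀ u v → loopColor u v ≡ loopColor v u
  loopColor-sym u v with u Finₚ.≟ v
  ... | yes refl = sym (loopColor-loop u)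
  ... | no u≢v = trans (cong just (proj₁ gallai u v u≢v)) (sym (loopColor-≢ (u≢v ∘ sym)))

  loopColor-gallai : ∀ u v w →
    loopColor u v ≡ loopColor u w ⊎ loopColor v w ≡ loopColor u v ⊎ loopColor v w ≡ loopColor u w
  loopColor-gallai u v w with u Finₚ.≟ v
  ... | yes refl = inj₂ (inj₂ refl)
  ... | no u≢v with u Finₚ.≟ w
  ...   | yes refl = inj₂ (inj₁ (trans (loopColor-≢ (u≢v ∘ sym)) (cong just (sym (proj₁ gallai u v u≢v)))))
  ...   | no u≢w with v Finₚ.≟ w
  ...     | yes refl = inj₁ refl
  ...     | no v≢w with c u v Finₚ.≟ c u w | c v w Finₚ.≟ c u v | c v w Finₚ.≟ c u w
  ...       | yes e | _ | _ = inj₁ (cong just e)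
  ...       | _ | yes e | _ = inj₂ (inj₁ (cong just e))
  ...       | _ | _ | yes e = inj₂ (inj₂ (cong just e))
  ...       | no p | no q | no r = contradiction (u≢v , v≢w , u≢w , (q ∘ sym) , r , p) (proj₂ gallai u v w)

  _≟ᶜ_ : DecidableEquality (Maybe (Fin k))
  _≟ᶜ_ = Maybeₚ.≡-dec Finₚ._≟_

  open LoopColored _≟ᶜ_ nothing loopColor loopColor-loop loopColor-nothing loopColor-sym loopColor-gallai

  palette : List (Maybe (Fin k))
  palette = map just (allFin k)

  palette-length : length palette ≤ k
  palette-length = ≤-reflexive (trans (length-map just (allFin k)) (length-tabulate {n = k} (λ i → i)))

  valid-if : ∀ {xs} → Unique xs → MonoFree xs → Valid palette xs
  valid-if uniq mono = valid uniq mono λ {u} {w} _ _ u≢w →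
    subst (_∈ palette) (sym (loopColor-≢ u≢w)) (∈-map⁺ just (∈-allFin (c u w)))

  vertices : List (Fin n)
  vertices = allFin n

  monoTriangle? : ∀ i j l → Dec (MonoTriangle c i j l)
  monoTriangle? i j l = ¬? (i Finₚ.≟ j) ×-dec ¬? (j Finₚ.≟ l) ×-dec ¬? (i Finₚ.≟ l)
    ×-dec (c i j Finₚ.≟ c j l) ×-dec (c j l Finₚ.≟ c i l)

  mono-exists : capacity k < n → ∃ λ i → ∃₂ λ j l → MonoTriangle c i j l
  mono-exists k<n with Finₚ.any? (λ i → Finₚ.any? (λ j → Finₚ.any? (λ l → monoTriangle? i j l)))
  ... | yes ∃mono = ∃mono
  ... | no none = contradiction (length-bound k palette-length (valid-if (allFin⁺ n) free))
                    (<⇒≱ (subst (capacity k <_) (sym (length-tabulate {n = n} (λ i → i))) k<n))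
    where
    free : MonoFree vertices
    free {d = nothing} _ _ _ d≢∅ _ _ _ = d≢∅ refl
    free {u} {v} {w} {just d} _ _ _ _ uv uw vw with loopColor-just uv | loopColor-just uw | loopColor-just vw
    ... | u≢v , uv≡d | u≢w , uw≡d | v≢w , vw≡d =
      none (u , v , w , u≢v , v≢w , u≢w , trans uv≡d (sym vw≡d) , trans vw≡d (sym uw≡d))

  -- The color `just d` entails distinct vertices, and the condition is invariant under permutation.
  Mono : Fin k → List (Fin n) → Set
  Mono d = AllPairs (λ u v → loopColor u v ≡ just d)

  mono-ordered : ∀ {d u v w} → Mono d (u ∷ v ∷ w ∷ []) → ∃ λ i → ∃₂ λ j l →
    OrderedMono c (i , j , l) × u ∷ v ∷ w ∷ [] ↭ i ∷ j ∷ l ∷ []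
  mono-ordered {d} mono@((uv ∷ uw ∷ []) ∷ (vw ∷ []) ∷ [] ∷ [])
    with sort₃ (proj₁ (loopColor-just uv)) (proj₁ (loopColor-just uw)) (proj₁ (loopColor-just vw))
  ... | i , j , l , i<j , j<l , perm
    with Permₛ.AllPairs-resp-↭ (setoid (Fin n)) (λ {x} {y} e → trans (loopColor-sym y x) e)
           ((λ { refl e → e }) , (λ { refl e → e })) (↭⇒↭ₛ perm) mono
  ...   | (ij ∷ il ∷ []) ∷ (jl ∷ []) ∷ [] ∷ [] with loopColor-just ij | loopColor-just il | loopColor-just jl
  ...     | _ , ij≡d | _ , il≡d | _ , jl≡d =
    i , j , l , (i<j , j<l , trans ij≡d (sym jl≡d) , trans jl≡d (sym il≡d)) , perm

  one-triangle : ∀ {d u v w} → Mono d (u ∷ v ∷ w ∷ []) → 1 ≤ numMono c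
  one-triangle mono with mono-ordered mono
  ... | _ , _ , _ , ordered , _ = numMono-≥ c ([] ∷ []) (ordered ∷ [])

  -- The vertex `x` lies in only one of the triangles, which therefore remain different after
  -- sorting.
  two-triangles : ∀ {d u v w d′ u′ v′ w′ x} → Mono d (u ∷ v ∷ w ∷ []) → Mono d′ (u′ ∷ v′ ∷ w′ ∷ []) →
    x ∈ u ∷ v ∷ w ∷ [] → x ∉ u′ ∷ v′ ∷ w′ ∷ [] → 2 ≤ numMono c
  two-triangles mono mono′ x∈ x∉ with mono-ordered mono | mono-ordered mono′
  ... | _ , _ , _ , ordered , perm | _ , _ , _ , ordered′ , perm′ = numMono-≥ c
    (((λ { refl → x∉ (∈-resp-↭ (↭-sym perm′) (∈-resp-↭ perm x∈)) }) ∷ []) ∷ [] ∷ []) (ordered ∷ ordered′ ∷ [])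

  mono-triple : ∀ {i j l} → MonoTriangle c i j l → Mono (c i j) (i ∷ j ∷ l ∷ [])
  mono-triple (i≢j , j≢l , i≢l , ij≡jl , jl≡il) =
    (loopColor-≢ i≢j ∷ trans (loopColor-≢ i≢l) (cong just (sym (trans ij≡jl jl≡il))) ∷ []) ∷
    (trans (loopColor-≢ j≢l) (cong just (sym ij≡jl)) ∷ []) ∷ [] ∷ []

  numMono-pos : capacity k < n → 1 ≤ numMono c
  numMono-pos k<n with mono-exists k<n
  ... | _ , _ , _ , mono = one-triangle (mono-triple mono)

  -- Two triangles when the number of colors is even.

  except : Fin n → List (Fin n)
  except x = filter (λ u → ¬? (u Finₚ.≟ x)) vertices

  ∈-except⁺ : ∀ {x u} → u ≢ x → u ∈ except x
  ∈-except⁺ {x} {u} = ∈-filter⁺ (λ w → ¬? (w Finₚ.≟ x)) (∈-allFin u)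

  ∈-except⁻ : ∀ {x u} → u ∈ except x → u ≢ x
  ∈-except⁻ {x} u∈ = proj₂ (∈-filter⁻ (λ w → ¬? (w Finₚ.≟ x)) {xs = vertices} u∈)

  except-unique : ∀ x → Unique (except x)
  except-unique x = filter⁺ (λ w → ¬? (w Finₚ.≟ x)) (allFin⁺ n)

  filter-only : ∀ x → filter (Finₚ._≟ x) vertices ≡ x ∷ []
  filter-only x = all-equal-unique (filter⁺ (Finₚ._≟ x) (allFin⁺ n)) (∈-filter⁺ (Finₚ._≟ x) (∈-allFin x) refl)
    (λ z∈ → proj₂ (∈-filter⁻ (Finₚ._≟ x) {xs = vertices} z∈))

  count-vertices : ∀ {P : Fin n → Set} (P? : Decidable P) x →
    count P? vertices ≡ count P? (x ∷ []) + count P? (except x)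
  count-vertices P? x = trans (count-split P? (Finₚ._≟ x) vertices)
    (cong (λ zs → count P? zs + count P? (except x)) (filter-only x))

  -- Deleting a vertex of the only monochromatic triangle leaves an extremal coloring, with even degrees.
  -- Delete x from the triangle {v, x, y} of color d: since y ∈ N_d(v), there is another u ∈ N_d(v).
  -- The degrees of u without v and without x are both even, so ux has color d like uv, and {u, v, x}
  -- is a second triangle.
  module _ {h} (k≡ : k ≡ h * 2) (n≡ : n ≡ suc (capacity (h * 2))) where

    except-length : ∀ x → length (except x) ≡ capacity (h * 2)
    except-length x = ≤-antisym
      (s≤s⁻¹ (≤-trans (filter-notAll (λ u → ¬? (u Finₚ.≟ x)) vertices (lose (∈-allFin x) (λ ≢ → ≢ refl)))
        (≤-reflexive len)))
      (s≤s⁻¹ (≤-trans (≤-reflexive (sym len)) (≤-trans (length-complement (Finₚ._≟ x) vertices)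
        (≤-reflexive (cong (λ zs → length zs + length (except x)) (filter-only x))))))
      where
      len : length vertices ≡ suc (capacity (h * 2))
      len = trans (length-tabulate {n = n} (λ i → i)) n≡

    second-triangle : ∀ {d v x y} → Mono d (v ∷ x ∷ y ∷ []) → 2 ≤ numMono c
    second-triangle {d} {v} {x} {y} mono@((vx ∷ vy ∷ []) ∷ (xy ∷ []) ∷ [] ∷ []) with 2 ≤? numMono c
    ... | yes 2≤ = 2≤
    ... | no 2≰ = contradiction second 2≰
      where
      -- A monochromatic triangle that avoids a vertex `z` of the given one would be a second
      -- triangle.
      free : ∀ {z} → z ∈ v ∷ x ∷ y ∷ [] → MonoFree (except z)
      free _ {d = nothing} _ _ _ d≢∅ _ _ _ = d≢∅ refl
      free {z} z∈ {d = just d′} p∈ q∈ r∈ _ pq pr qr =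
        2≰ (two-triangles mono ((pq ∷ pr ∷ []) ∷ (qr ∷ []) ∷ [] ∷ []) z∈ z∉)
        where
        z∉ : z ∉ _
        z∉ (here refl) = ∈-except⁻ p∈ refl
        z∉ (there (here refl)) = ∈-except⁻ q∈ refl
        z∉ (there (there (here refl))) = ∈-except⁻ r∈ refl

      even : ∀ {z} → z ∈ v ∷ x ∷ y ∷ [] → ∀ {u} → u ≢ z → 2 ∣ length (neighbors (except z) u (just d))
      even {z} z∈ u≢z = even-degree h (≤-trans palette-length (≤-reflexive k≡))
        (valid-if (except-unique z) (free z∈)) (except-length z) (∈-except⁺ u≢z) (λ ())

      D? : ∀ u → Decidable (λ w → loopColor u w ≡ just d)
      D? u w = loopColor u w ≟ᶜ just d

      v≢x : v ≢ x
      v≢x = proj₁ (loopColor-just vx)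

      u-witness : ∃ λ u → u ∈ neighbors (except x) v (just d) × u ≢ y
      u-witness = another (filter⁺ (D? v) (except-unique x)) (even (there (here refl)) v≢x)
        (∈-filter⁺ (D? v) (∈-except⁺ (proj₁ (loopColor-just xy) ∘ sym)) vy)

      second : 2 ≤ numMono c
      second with u-witness
      ... | u , u∈ , u≢y with ∈-filter⁻ (D? v) {xs = except x} u∈
      ...   | u∈x , vu with ∈-except⁻ u∈x
      ...     | u≢x with loopColor u x ≟ᶜ just d
      ...       | yes ux = two-triangles ((vu ∷ vx ∷ []) ∷ (ux ∷ []) ∷ [] ∷ []) mono (there (here refl))
        λ { (here refl)                 → proj₁ (loopColor-just vu) refl
          ; (there (here refl))         → u≢x refl
          ; (there (there (here refl))) → u≢y refl }
      ...       | no ¬ux = contradiction (∣1⇒≡1 (∣m+n∣m⇒∣n (subst (2 ∣_) (+-comm 1 _) odd-even) (even (here refl) u≢v))) λ ()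
        where
        u≢v : u ≢ v
        u≢v = proj₁ (loopColor-just vu) ∘ sym
        uv : loopColor u v ≡ just d
        uv = trans (loopColor-sym u v) vu
        -- Since `u x` does not have color `d` and `u v` does, deleting `x` keeps the `d`-degree of
        -- `u` and deleting `v` lowers it by one; both results cannot be even.
        odd-even : 2 ∣ 1 + length (neighbors (except v) u (just d))
        odd-even = subst (2 ∣_) (begin
          length (neighbors (except x) u (just d))
            ≡⟨ cong (λ zs → length zs + length (neighbors (except x) u (just d))) (filter-reject (D? u) {x} {[]} ¬ux) ⟨
          count (D? u) (x ∷ []) + length (neighbors (except x) u (just d)) ≡⟨ count-vertices (D? u) x ⟨
          count (D? u) vertices ≡⟨ count-vertices (D? u) v ⟩
          count (D? u) (v ∷ []) + length (neighbors (except v) u (just d))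
            ≡⟨ cong (λ zs → length zs + length (neighbors (except v) u (just d))) (filter-accept (D? u) {v} {[]} uv) ⟩
          1 + length (neighbors (except v) u (just d)) ∎)
          (even (there (here refl)) u≢x)
          where open ≡-Reasoning

    numMono-≥2 : 2 ≤ numMono c
    numMono-≥2 with mono-exists (≤-reflexive (trans (cong (suc ∘ capacity) k≡) (sym n≡)))
    ... | _ , _ , _ , mono = second-triangle (mono-triple mono)

-- The pentagon and its two shades.

adjacent : Fin 5 → Fin 5 → Bool
adjacent r s = does (suc (toℕ r) mod 5 Finₚ.≟ s) ∨ does (suc (toℕ s) mod 5 Finₚ.≟ r)

adjacent-sym : ∀ r s → adjacent r s ≡ adjacent s r
adjacent-sym = from-yes (Finₚ.all? λ r → Finₚ.all? λ s → adjacent r s Boolₚ.≟ adjacent s r)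

-- Neither the 5-cycle nor its complement, again a 5-cycle, contains a triangle; checked over all
-- cases.
adjacent-mono-free : ∀ r s t → r ≢ s → s ≢ t → r ≢ t →
  adjacent r s ≡ adjacent s t → adjacent s t ≢ adjacent r t
adjacent-mono-free = from-yes (Finₚ.all? λ r → Finₚ.all? λ s → Finₚ.all? λ t →
  ¬? (r Finₚ.≟ s) →-dec ¬? (s Finₚ.≟ t) →-dec ¬? (r Finₚ.≟ t) →-dec
  (adjacent r s Boolₚ.≟ adjacent s t) →-dec ¬? (adjacent s t Boolₚ.≟ adjacent r t))

shade : ∀ {k} → Bool → Fin (2 + k)
shade b = if b then zero else suc zero

shade-injective : ∀ {k} a b → shade {k} a ≡ shade b → a ≡ b
shade-injective true  true  _ = refl
shade-injective false false _ = refl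

shades-repeat : ∀ {k} a b d → shade {k} a ≢ shade b → shade b ≢ shade {k} d → shade {k} a ≡ shade d
shades-repeat true  true  _     p _ = contradiction refl p
shades-repeat true  false true  _ _ = refl
shades-repeat true  false false _ q = contradiction refl q
shades-repeat false true  true  _ q = contradiction refl q
shades-repeat false true  false _ _ = refl
shades-repeat false false _     p _ = contradiction refl p

deepen : ∀ {k} → Fin k → Fin (2 + k)
deepen e = suc (suc e)

deepen≢shade : ∀ {k} {e : Fin k} b → deepen e ≢ shade b
deepen≢shade true  ()
deepen≢shade false ()

-- The digit coloring.

residue : ℕ → Fin 5
residue x = x mod 5

-- In color 1, two numbers with equal residues are treated as nonadjacent and get the last color.
color : ∀ k → ℕ → ℕ → Fin (suc k)
color 0 x y = zero
color 1 x y = shade (adjacent (residue x) (residue y))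
color (suc (suc k)) x y with residue x Finₚ.≟ residue y
... | yes _ = deepen (color k (x / 5) (y / 5))
... | no _  = shade (adjacent (residue x) (residue y))

color-inner : ∀ k x y → residue x ≡ residue y → color (2 + k) x y ≡ deepen (color k (x / 5) (y / 5))
color-inner k x y e with residue x Finₚ.≟ residue y
... | yes _ = refl
... | no ≢  = contradiction e ≢

color-outer : ∀ k x y → residue x ≢ residue y → color (2 + k) x y ≡ shade (adjacent (residue x) (residue y))
color-outer k x y ≢ with residue x Finₚ.≟ residue y
... | yes e = contradiction e ≢
... | no _  = refl

color-sym : ∀ k x y → color k x y ≡ color k y x
color-sym 0 x y = refl
color-sym 1 x y = cong shade (adjacent-sym (residue x) (residue y))
color-sym (suc (suc k)) x y with residue x Finₚ.≟ residue y
... | yes e = trans (cong deepen (color-sym k (x / 5) (y / 5))) (sym (color-inner k y x (sym e)))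
... | no ≢  = trans (cong shade (adjacent-sym (residue x) (residue y))) (sym (color-outer k y x (≢ ∘ sym)))

-- If all residues agree, the quotients decide; if all differ, only two shades are available; if
-- exactly two agree, the third vertex sees both in the same shade.
color-no-rainbow : ∀ k x y z → color k x y ≢ color k y z → color k y z ≢ color k x z → color k x y ≡ color k x z
color-no-rainbow 0 x y z _ _ = refl
color-no-rainbow 1 x y z = shades-repeat
  (adjacent (residue x) (residue y)) (adjacent (residue y) (residue z)) (adjacent (residue x) (residue z))
color-no-rainbow (suc (suc k)) x y z p q
  with residue x Finₚ.≟ residue y | residue y Finₚ.≟ residue z | residue x Finₚ.≟ residue z
... | yes _   | yes _   | yes _  = cong deepen
  (color-no-rainbow k (x / 5) (y / 5) (z / 5) (p ∘ cong deepen) (q ∘ cong deepen))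
... | no _    | no _    | no _   = shades-repeat
  (adjacent (residue x) (residue y)) (adjacent (residue y) (residue z)) (adjacent (residue x) (residue z)) p q
... | yes x~y | yes y~z | no x≁z = contradiction (trans x~y y~z) x≁z
... | yes x~y | no y≁z  | yes x~z = contradiction (trans (sym x~y) x~z) y≁z
... | no x≁y  | yes y~z | yes x~z = contradiction (trans x~z (sym y~z)) x≁y
... | yes x~y | no _    | no _   = contradiction (cong (λ r → shade (adjacent r (residue z))) (sym x~y)) q
... | no _    | yes y~z | no _   = cong (λ r → shade (adjacent (residue x) r)) y~z
... | no _    | no _    | yes x~z = contradiction
  (trans (cong shade (adjacent-sym (residue x) (residue y))) (cong (λ r → shade (adjacent (residue y) r)) x~z)) p

-- Monochromatic triples of the digit coloring.

-- `color k` has `suc k` colors, so these are triples among `0` to `capacity (suc k)`. For two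
-- colors, `5` repeats the residue of `0` and is nonadjacent to it; the two residues nonadjacent to
-- `0` give the two triangles.
monoTriples : ℕ → List (ℕ × ℕ × ℕ)
monoTriples 0 = (0 , 1 , 2) ∷ []
monoTriples 1 = (0 , 2 , 5) ∷ (0 , 3 , 5) ∷ []
monoTriples (suc (suc k)) = map (λ (x , y , z) → x * 5 , y * 5 , z * 5) (monoTriples k)

-- Every triangle uses the last vertex, so one vertex fewer leaves none.
monoTriples-top : ∀ k {x y z} → (x , y , z) ∈ monoTriples k → z ≡ capacity (suc k)
monoTriples-top 0 (here refl) = refl
monoTriples-top 1 (here refl) = refl
monoTriples-top 1 (there (here refl)) = refl
monoTriples-top (suc (suc k)) t∈ with ∈-map⁻ (λ (x , y , z) → x * 5 , y * 5 , z * 5) t∈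
... | (_ , _ , z) , t′∈ , refl = trans (cong (_* 5) (monoTriples-top k t′∈)) (*-comm (capacity (suc k)) 5)

decompose : ∀ x → x ≡ toℕ (residue x) + x / 5 * 5
decompose x = trans (m≡m%n+[m/n]*n x 5) (cong (_+ x / 5 * 5) (sym (Finₚ.toℕ-fromℕ< _)))

quotient-< : ∀ {x y} → residue x ≡ residue y → x < y → x / 5 < y / 5
quotient-< {x} {y} e x<y = ≤∧≢⇒< (/-mono-≤ (<⇒≤ x<y) (≤-refl {5})) λ q → <-irrefl (begin
  x                         ≡⟨ decompose x ⟩
  toℕ (residue x) + x / 5 * 5 ≡⟨ cong₂ (λ r q → toℕ r + q * 5) e q ⟩
  toℕ (residue y) + y / 5 * 5 ≡⟨ decompose y ⟨
  y                         ∎) x<y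
  where open ≡-Reasoning

six-vertices : ∀ (x y z : Fin 6) → toℕ x < toℕ y → toℕ y < toℕ z →
  color 1 (toℕ x) (toℕ y) ≡ color 1 (toℕ y) (toℕ z) → color 1 (toℕ y) (toℕ z) ≡ color 1 (toℕ x) (toℕ z) →
  (toℕ x , toℕ y , toℕ z) ∈ monoTriples 1
six-vertices = from-yes (Finₚ.all? {6} λ x → Finₚ.all? {6} λ y → Finₚ.all? {6} λ z →
  (toℕ x <? toℕ y) →-dec (toℕ y <? toℕ z) →-dec
  (color 1 (toℕ x) (toℕ y) Finₚ.≟ color 1 (toℕ y) (toℕ z)) →-dec
  (color 1 (toℕ y) (toℕ z) Finₚ.≟ color 1 (toℕ x) (toℕ z)) →-dec
  Any.any? ((toℕ x , toℕ y , toℕ z) ≟³_) (monoTriples 1))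
  where
  _≟³_ = Productₚ.≡-dec _≟_ (Productₚ.≡-dec _≟_ _≟_)

-- If just two residues agreed, a shade would equal a deeper color; three different residues would
-- give a triangle in the pentagon or its complement. So all agree, and the quotients form a
-- monochromatic triple of `color k`.
mono-color : ∀ k {x y z} → x < y → y < z → z ≤ capacity (suc k) →
  color k x y ≡ color k y z → color k y z ≡ color k x z → (x , y , z) ∈ monoTriples k
mono-color 0 {0} {1} {2} _ _ _ _ _ = here refl
mono-color 0 {suc _} {1} (s≤s ())
mono-color 0 {_} {suc (suc _)} {suc (suc (suc _))} _ _ (s≤s (s≤s ()))
mono-color 0 {_} {suc (suc _)} {1} _ (s≤s ())
mono-color 0 {_} {suc (suc _)} {2} _ (s≤s (s≤s ()))
mono-color 0 {_} {1} {suc (suc (suc _))} _ _ (s≤s (s≤s ()))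
mono-color 0 {_} {1} {1} _ (s≤s ())
-- All three numbers are below six, so the finite check over `Fin 6` is carried back to numbers.
mono-color 1 {x} {y} {z} x<y y<z z≤5 = subst₂ (λ a bc → Claim a (proj₁ bc) (proj₂ bc))
  (Finₚ.toℕ-fromℕ< x<6) (cong₂ _,_ (Finₚ.toℕ-fromℕ< y<6) (Finₚ.toℕ-fromℕ< z<6))
  (six-vertices (fromℕ< x<6) (fromℕ< y<6) (fromℕ< z<6)) x<y y<z
  where
  Claim : ℕ → ℕ → ℕ → Set
  Claim x y z = x < y → y < z → color 1 x y ≡ color 1 y z → color 1 y z ≡ color 1 x z → (x , y , z) ∈ monoTriples 1
  z<6 = s≤s z≤5
  y<6 = ≤-trans y<z (<⇒≤ z<6)
  x<6 = ≤-trans x<y (<⇒≤ y<6)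
mono-color (suc (suc k)) {x} {y} {z} x<y y<z z≤ p q
  with residue x Finₚ.≟ residue y | residue y Finₚ.≟ residue z | residue x Finₚ.≟ residue z
... | yes x~y | yes y~z | no x≁z  = contradiction (trans x~y y~z) x≁z
... | yes x~y | no y≁z  | _       = contradiction p (deepen≢shade (adjacent (residue y) (residue z)))
... | no x≁y  | yes y~z | _       = contradiction (sym p) (deepen≢shade (adjacent (residue x) (residue y)))
... | no x≁y  | no y≁z  | yes x~z = contradiction (sym q) (deepen≢shade (adjacent (residue y) (residue z)))
... | no x≁y  | no y≁z  | no x≁z  = contradiction (shade-injective (adjacent (residue y) (residue z)) _ q)
  (adjacent-mono-free (residue x) (residue y) (residue z) x≁y y≁z x≁z
    (shade-injective (adjacent (residue x) (residue y)) _ p))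
... | yes x~y | yes y~z | yes _   = subst (_∈ monoTriples (2 + k))
  (cong₂ _,_ (multiple x~z) (cong₂ _,_ (multiple y~z) (multiple refl)))
  (∈-map⁺ (λ (x , y , z) → x * 5 , y * 5 , z * 5) inner)
  where
  x~z = trans x~y y~z
  C = capacity (suc k)
  z/5≤ : z / 5 ≤ C
  z/5≤ = ≤-trans (/-mono-≤ (≤-trans z≤ (≤-reflexive (*-comm 5 C))) (≤-refl {5})) (≤-reflexive (m*n/n≡m C 5))
  inner : (x / 5 , y / 5 , z / 5) ∈ monoTriples k
  inner = mono-color k (quotient-< x~y x<y) (quotient-< y~z y<z) z/5≤
    (Finₚ.suc-injective (Finₚ.suc-injective p)) (Finₚ.suc-injective (Finₚ.suc-injective q))
  -- The quotient of `z` is already the top value `C`, so `z ≤ 5 * C` leaves no room for a nonzero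
  -- residue. All three numbers are then multiples of five.
  residue-z : residue z ≡ zero
  residue-z = Finₚ.toℕ-injective (n≤0⇒n≡0 (+-cancelʳ-≤ (C * 5) _ 0 (begin
    toℕ (residue z) + C * 5       ≡⟨ cong (λ n → toℕ (residue z) + n * 5) (monoTriples-top k inner) ⟨
    toℕ (residue z) + z / 5 * 5   ≡⟨ decompose z ⟨
    z                             ≤⟨ z≤ ⟩
    5 * C                         ≡⟨ *-comm 5 C ⟩
    C * 5                         ∎)))
    where open ≤-Reasoning
  multiple : ∀ {t} → residue t ≡ residue z → t / 5 * 5 ≡ t
  multiple {t} e = sym (trans (decompose t) (cong (λ r → toℕ r + t / 5 * 5) (trans e residue-z)))

-- The Gallai-Ramsey number and the minimum number of triangles.

digitColoring : ∀ k n → Coloring (suc k) n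
digitColoring k n i j = color k (toℕ i) (toℕ j)

digitColoring-gallai : ∀ k n → Gallai (suc k) n (digitColoring k n)
digitColoring-gallai k n = (λ i j _ → color-sym k (toℕ i) (toℕ j)) ,
  λ i j l (_ , _ , _ , p , q , r) → r (color-no-rainbow k (toℕ i) (toℕ j) (toℕ l) p q)

-- A monochromatic triangle would contain the vertex `capacity (suc k)`, which is not below `n`.
digitColoring-mono-free : ∀ k {n} → n ≤ capacity (suc k) → ¬ ForcesMono (suc k) n
digitColoring-mono-free k {n} n≤ forces with forces (digitColoring k n) (digitColoring-gallai k n)
... | i , j , l , mono with mono-ordered (mono-triple mono)
  where open GallaiColored (digitColoring k n) (digitColoring-gallai k n)
...   | i′ , j′ , l′ , (i<j , j<l , p , q) , _ = <-irrefl
  (monoTriples-top k (mono-color k i<j j<l (≤-trans (<⇒≤ (Finₚ.toℕ<n l′)) n≤) p q))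
  (≤-trans (Finₚ.toℕ<n l′) n≤)

-- An upper bound suffices: together with the lower bound for all Gallai colorings it determines the
-- number.
digitColoring-numMono : ∀ k → numMono (digitColoring k (suc (capacity (suc k)))) ≤ length (monoTriples k)
digitColoring-numMono k = ≤-trans (≤-reflexive (trans (numMono≡count c) (sym (length-map values ts))))
  (unique-⊆-length (map⁺ values-injective (filter⁺ (orderedMono? c) (triples-unique n))) listed)
  where
  n = suc (capacity (suc k))
  c = digitColoring k n
  ts = filter (orderedMono? c) (triples n)
  values : Triple n → ℕ × ℕ × ℕ
  values (i , j , l) = toℕ i , toℕ j , toℕ l
  values-injective : ∀ {s t} → values s ≡ values t → s ≡ t
  values-injective e = cong₂ _,_ (Finₚ.toℕ-injective (cong proj₁ e))
    (cong₂ _,_ (Finₚ.toℕ-injective (cong (proj₁ ∘ proj₂) e)) (Finₚ.toℕ-injective (cong (proj₂ ∘ proj₂) e)))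
  listed : ∀ {t} → t ∈ map values ts → t ∈ monoTriples k
  listed t∈ with ∈-map⁻ values t∈
  ... | (i , j , l) , s∈ , refl with proj₂ (∈-filter⁻ (orderedMono? c) {xs = triples n} s∈)
  ...   | i<j , j<l , p , q = mono-color k i<j j<l (s≤s⁻¹ (Finₚ.toℕ<n l)) p q

-- The index `h * 2` stands for `suc (h * 2)` colors, so this count belongs to an odd number of
-- colors.
monoTriples-even : ∀ h → length (monoTriples (h * 2)) ≡ 1
monoTriples-even zero    = refl
monoTriples-even (suc h) = trans (length-map _ (monoTriples (h * 2))) (monoTriples-even h)

monoTriples-odd : ∀ h → length (monoTriples (suc (h * 2))) ≡ 2
monoTriples-odd zero    = refl
monoTriples-odd (suc h) = trans (length-map _ (monoTriples (suc (h * 2)))) (monoTriples-odd h)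

theorem4p1 : (k : ℕ) → 1 ≤ k →
    Σ ℕ λ N → IsGR k N ×
    (((o : ℕ) → k ≡ 2 * o + 1 → IsG k N 1) ×
    ((e : ℕ) → k ≡ 2 * e → IsG k N 2))
theorem4p1 (suc k) _ = N , (forces , λ M M<N → digitColoring-mono-free k (s≤s⁻¹ M<N)) , odd , even
  where
  N = suc (capacity (suc k))
  extremal = digitColoring k N
  extremal-gallai = digitColoring-gallai k N

  forces : ForcesMono (suc k) N
  forces c gallai = GallaiColored.mono-exists c gallai ≤-refl

  attained : ∀ {m} → length (monoTriples k) ≡ m → (∀ c → Gallai (suc k) N c → m ≤ numMono c) → IsG (suc k) N m
  attained len lower = (extremal , extremal-gallai ,
    ≤-antisym (≤-trans (digitColoring-numMono k) (≤-reflexive len)) (lower extremal extremal-gallai)) , lower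

  odd : ∀ o → suc k ≡ 2 * o + 1 → IsG (suc k) N 1
  odd o k≡ = attained (trans (cong (length ∘ monoTriples) k≡′) (monoTriples-even o))
    λ c gallai → GallaiColored.numMono-pos c gallai ≤-refl
    where
    k≡′ : k ≡ o * 2
    k≡′ = suc-injective (trans k≡ (trans (+-comm (2 * o) 1) (cong suc (*-comm 2 o))))

  even : ∀ e → suc k ≡ 2 * e → IsG (suc k) N 2
  even (suc h) k≡ = attained (trans (cong (length ∘ monoTriples) (suc-injective k≡′)) (monoTriples-odd h))
    λ c gallai → GallaiColored.numMono-≥2 c gallai {suc h} k≡′ (cong (suc ∘ capacity) k≡′)
    where
    k≡′ : suc k ≡ suc h * 2
    k≡′ = trans k≡ (*-comm 2 (suc h))
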